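{- There exists $d_0$ such that for every integer $d\ge d_0$ there exists $n_0$ such that for every even $n\ge n_0$, every $k$ with $1\le k\le n/100$, and every $S\subset V=[n]$ with $|S|=k$, a sample $H\sim\mathcal{G}_{\mathrm{reg}}(n,d)$ satisfies, with probability at least $1-2\binom{n}{k}^{ -1.01}$, \[ \left| \frac{\mathrm{cut}_H(S)}{\mathbb{E}_{H\sim\mathcal{G}_{\mathrm{reg}}(n,d)}[\mathrm{cut}_H(S)]} - 1\right| \le \frac{1.5}{\sqrt d}. \]
   Context: $\mathcal{G}_{\mathrm{reg}}(n,d)$ ($n$ even) is the distribution of the $d$-regular multigraph on $[n]$ obtained as the disjoint union of $d$ independent uniformly random perfect matchings. $\mathrm{cut}_H(S)$ is the number of edges (with multiplicity) of $H$ with exactly one endpoint in $S$. -}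

module Defs where

open import Data.Bool using (Bool; true; false; _∧_; not; if_then_else_)
open import Data.Nat using (ℕ; zero; suc; _+_; _*_; _^_; _≤ᵇ_; ∣_-_∣)
open import Data.Fin using (Fin; _≟_)
open import Data.Fin.Subset using (Subset)
open import Data.List using (List; []; _∷_; map; concatMap; filterᵇ; length; allFin)
open import Data.Nat.ListAction using (sum)
open import Data.Bool.ListAction using (all)
open import Data.Vec using (Vec; []; _∷_; lookup; toList)
open import Relation.Nullary.Decidable using (⌊_⌋)

allVecs : ∀ {A : Set} → List A → (m : ℕ) → List (Vec A m)
allVecs xs zero    = [] ∷ []
allVecs xs (suc m) = concatMap (λ x → map (x ∷_) (allVecs xs m)) xs

-- A perfect matching on [n] is encoded as a fixed-point-free involution
-- f : Fin n → Fin n (stored as the vector of its values); i is matched to f i.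
isMatchingᵇ : ∀ {n} → Vec (Fin n) n → Bool
isMatchingᵇ {n} f =
  all (λ i → not ⌊ lookup f i ≟ i ⌋ ∧ ⌊ lookup f (lookup f i) ≟ i ⌋) (allFin n)

perfectMatchings : (n : ℕ) → List (Vec (Fin n) n)
perfectMatchings n = filterᵇ isMatchingᵇ (allVecs (allFin n) n)

-- The sample space of G_reg(n,d): all d-tuples of perfect matchings,
-- each tuple having equal probability (uniform, independent matchings).
-- The multigraph H is the disjoint union of the d matchings of the tuple.
regSamples : (n d : ℕ) → List (Vec (Vec (Fin n) n) d)
regSamples n d = allVecs (perfectMatchings n) d

-- Number of edges of a matching with exactly one endpoint in S
-- (each such edge is counted once, via its endpoint in S).
cutMatching : ∀ {n} → Subset n → Vec (Fin n) n → ℕ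
cutMatching {n} S f =
  length (filterᵇ (λ i → lookup S i ∧ not (lookup S (lookup f i))) (allFin n))

cutH : ∀ {n d} → Subset n → Vec (Vec (Fin n) n) d → ℕ
cutH S H = sum (map (cutMatching S) (toList H))

-- Sum of cut_H(S) over the sample space; E[cut_H(S)] = cutSum / |sample space|.
cutSum : (n d : ℕ) → Subset n → ℕ
cutSum n d S = sum (map (cutH S) (regSamples n d))

-- The event | cut_H(S) / E[cut_H(S)] - 1 | ≤ 1.5 / √d, written exactly
-- without division/roots: with T = |space|, Σ = cutSum, E = Σ / T,
--   |cut·T − Σ| / Σ ≤ 3/(2√d)  ⟺  4·d·|cut·T − Σ|² ≤ 9·Σ².
goodᵇ : (n d : ℕ) → Subset n → Vec (Vec (Fin n) n) d → Bool
goodᵇ n d S H =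
  (4 * d * (∣ cutH S H * length (regSamples n d) - cutSum n d S ∣ ^ 2))
    ≤ᵇ (9 * (cutSum n d S ^ 2))

badCount : (n d : ℕ) → Subset n → ℕ
badCount n d S = length (filterᵇ (λ H → not (goodᵇ n d S H)) (regSamples n d))

{-# OPTIONS --safe #-}

-- Write cut = dk − 2I, where I counts the edges inside S; its mean is
-- μ = dk(k−1)/2(n−1). Exposing the partners of the vertices of S one by one shows,
-- for a single matching and every y > −1, that E[(1+y)ᴵ] ≤ exp(y E[I]), which with
-- exp(y) ≤ (1+y)^(1+y) becomes E[(1+y)ᴵ] ≤ (1+y)^((1+y) E[I]); by independence the
-- same holds for d matchings. Chernoff's method with 1+y ≈ 1 + t/2μ for the upper
-- and its inverse for the lower tail then bounds P[|I − μ| ≥ t] by 2 (1 + t/2μ)^(−t/2).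
-- For t = 3√d k(n−k)/4(n−1) and large d this is below 2 C(n,k)⁻², by
-- C(n,k) ≤ (4n/k)ᵏ. No real numbers occur: exp is replaced by powers of 1 + y/N with
-- N divisible by all denominators, and the inequalities are compared after raising
-- them to a power that clears the exponents.

module Submission where

open import Defs
open import Data.Nat using (ℕ; _+_; _*_; _^_; _≤_)
open import Data.Nat.Divisibility using (_∣_)
open import Data.Nat.Combinatorics using (_C_)
open import Data.Fin.Subset using (Subset; ∣_∣)
open import Data.List using (length)
open import Data.Product using (∃)
open import Relation.Binary.PropositionalEquality using (_≡_)

open import Data.Bool using (Bool; true; false; T; T?; not; _∧_)
open import Data.Bool.Properties using (T-≡; T-∧; T-not-≡)
open import Data.Fin using (Fin; zero; suc; _≟_)
open import Data.List using (List; []; _∷_; _++_; map; concatMap; concat; filter; filterᵇ; allFin; replicate; tabulate)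
open import Data.List.Properties using (length-map; length-++; length-tabulate; map-++; map-∘; map-cong; map-cong-local; map-id-local; concatMap-map; concatMap-++)
open import Data.List.Membership.Propositional using (_∈_; _∉_; find; lose)
open import Data.List.Membership.Propositional.Properties using (∈-concatMap⁺; ∈-concatMap⁻; ∈-map⁺; ∈-map⁻; ∈-filter⁺; ∈-filter⁻; ∈-allFin; ∈-++⁺ˡ; ∈-++⁺ʳ)
open import Data.List.Membership.Propositional.Properties.WithK using (unique∧set⇒bag)
open import Data.List.Relation.Binary.BagAndSetEquality using (∼bag⇒↭)
open import Data.List.Relation.Binary.Disjoint.Propositional using (Disjoint)
open import Data.List.Relation.Binary.Permutation.Propositional as ↭ using (_↭_; prep; swap; ↭-sym)
open import Data.List.Relation.Binary.Permutation.Propositional.Properties using (∈-resp-↭; All-resp-↭; ↭-length) renaming (map⁺ to ↭-map⁺)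
open import Data.List.Relation.Unary.All using (All; []; _∷_)
import Data.List.Relation.Unary.All as All
import Data.List.Relation.Unary.All.Properties as All
open import Data.List.Relation.Unary.AllPairs using (AllPairs; []; _∷_)
import Data.List.Relation.Unary.AllPairs as AllPairs
import Data.List.Relation.Unary.AllPairs.Properties as AllPairs
open import Data.List.Relation.Unary.Any using (here; there)
open import Data.List.Relation.Unary.Unique.Propositional using (Unique)
import Data.List.Relation.Unary.Unique.Propositional.Properties as Unique
open import Data.Nat using (zero; suc; pred; _∸_; _/_; _!; _<_; z≤n; s≤s; NonZero; >-nonZero; >-nonZero⁻¹; ⌊_/2⌋; ∣_-_∣)
open import Data.Nat.Combinatorics using (nCk+nC[k+1]≡[n+1]C[k+1]; nCk≡nC[n∸k]; nCn≡1; k>n⇒nCk≡0)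
open import Data.Nat.DivMod using (m*[n/m]≡n)
open import Data.Nat.Divisibility using (m≤n⇒m!∣n!; ∣-trans; m∣m*n)
open import Data.Nat.ListAction using (sum)
open import Data.Nat.ListAction.Properties using (sum-++; sum-↭)
open import Data.Nat.Properties hiding (_≟_)
open import Data.Nat.Tactic.RingSolver using (solve-∀)
open import Data.Product using (_,_; _×_; proj₁; proj₂; map₂)
open import Data.Sum using (_⊎_; inj₁; inj₂)
open import Data.Vec using (Vec; []; _∷_; lookup; _[_]≔_)
import Data.Vec as Vec
import Data.Vec.Properties as Vec
open import Function using (_∘_; _on_; mk⇔; Equivalence)
open import Relation.Nullary using (¬_; yes; no; does)
open import Relation.Nullary.Decidable using (⌊_⌋; toWitness; fromWitness; toWitnessFalse; fromWitnessFalse)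
open import Relation.Nullary.Negation using (contradiction)
open import Relation.Unary using (Decidable)
open import Relation.Binary.PropositionalEquality using (_≢_; refl; sym; trans; cong; cong₂; subst; subst₂; module ≡-Reasoning)

-- Enumeration of perfect matchings

-- A bounded-difference martingale bound on the cut itself yields only exp(-ck) at the deviation 1.5
-- √d k. The exponent lacks a factor log(n/k), so this cannot beat C(n,k) when k is much smaller
-- than n. Edges inside S are rare, however: μ ≈ dk²/2n, while I may deviate by t ≈ 3√d k/4. The
-- Poisson-type tail earns log(1 + c n/(√d k)) per unit of t, and for large d a total of √d k such
-- units outweighs k log(n/k). When √d exceeds n/k the logarithm is only of order n/(√d k), but the
-- total is then of order n, which suffices because k ≤ n/100. The edges inside S are dependent. The
-- induction survives because exposing one edge shifts the conditional mean of the others in a way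
-- that is absorbed by (1 + yq)(1 + y(1 - q)) = 1 + y + y² q(1 - q). The surplus is a nonnegative
-- multiple of y², so one lemma serves both tails.

copies : ∀ {A : Set} → ℕ → List A → List A
copies k xs = concat (replicate k xs)

-- The number (m − 1)!! of perfect matchings of m vertices; it is 0 for odd m.
matchings# : ℕ → ℕ
matchings# 0             = 1
matchings# 1             = 0
matchings# (suc (suc m)) = suc m * matchings# m

-- The multiset of cut sizes over all perfect matchings of s vertices inside S
-- and t vertices outside, obtained by exposing the edge at a vertex of S as long
-- as there is one.
cuts : ℕ → ℕ → List ℕ
cuts 0             0             = 0 ∷ []
cuts 0             1             = []
cuts 0             (suc (suc t)) = copies (suc t) (cuts 0 t)
cuts 1             t             = copies t (map suc (cuts 0 (pred t)))
cuts (suc (suc s)) t             =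
  copies (suc s) (cuts s t) ++ copies t (map suc (cuts (suc s) (pred t)))

Unique-resp-↭ : ∀ {A : Set} {xs ys : List A} → xs ↭ ys → Unique xs → Unique ys
Unique-resp-↭ ↭.refl        u                       = u
Unique-resp-↭ (prep x p)    (x∉ ∷ u)                = All-resp-↭ p x∉ ∷ Unique-resp-↭ p u
Unique-resp-↭ (swap x y p)  ((x≢y ∷ x∉) ∷ (y∉ ∷ u)) =
  (x≢y ∘ sym ∷ All-resp-↭ p y∉) ∷ (All-resp-↭ p x∉ ∷ Unique-resp-↭ p u)
Unique-resp-↭ (↭.trans p q) u                       = Unique-resp-↭ q (Unique-resp-↭ p u)

Unique-concatMap : ∀ {A B : Set} (g : A → List B) {xs} →
  All (Unique ∘ g) xs → AllPairs (Disjoint on g) xs → Unique (concatMap g xs)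
Unique-concatMap g us ds = Unique.concat⁺ (All.map⁺ us) (AllPairs.map⁺ ds)

map-concatMap-const : ∀ {A B C : Set} (f : B → C) (g : A → List B) {ys} xs →
  (∀ {x} → x ∈ xs → map f (g x) ≡ ys) → map f (concatMap g xs) ≡ copies (length xs) ys
map-concatMap-const f g []       h = refl
map-concatMap-const f g (x ∷ xs) h = trans (map-++ f (g x) (concatMap g xs))
  (cong₂ _++_ (h (here refl)) (map-concatMap-const f g xs (h ∘ there)))

-- Removal is by position and keeps the order, so `picks` splits along `_++_`: the possible partners
-- of an exposed vertex separate into those in `S` and those outside.
picks : ∀ {A : Set} → List A → List (A × List A)
picks []       = []
picks (x ∷ xs) = (x , xs) ∷ map (map₂ (x ∷_)) (picks xs)

module _ {A : Set} where

  picks-↭ : ∀ {L : List A} {b L′} → (b , L′) ∈ picks L → L ↭ b ∷ L′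
  picks-↭ {x ∷ xs} (here refl) = ↭.refl
  picks-↭ {x ∷ xs} (there p) with ((b , L′) , p′ , refl) ← ∈-map⁻ (map₂ (x ∷_)) p =
    ↭.trans (prep x (picks-↭ p′)) (swap x b ↭.refl)

  ∈⇒picks : ∀ {L : List A} {b} → b ∈ L → ∃ λ L′ → (b , L′) ∈ picks L
  ∈⇒picks {x ∷ xs} (here refl) = xs , here refl
  ∈⇒picks {x ∷ xs} (there b∈xs) with (L′ , p) ← ∈⇒picks b∈xs =
    x ∷ L′ , there (∈-map⁺ (map₂ (x ∷_)) p)

  map-proj₁-picks : ∀ (L : List A) → map proj₁ (picks L) ≡ L
  map-proj₁-picks []       = refl
  map-proj₁-picks (x ∷ xs) = cong (x ∷_) (trans (sym (map-∘ (picks xs))) (map-proj₁-picks xs))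

  length-picks : ∀ (L : List A) → length (picks L) ≡ length L
  length-picks L = trans (sym (length-map proj₁ (picks L))) (cong length (map-proj₁-picks L))

  picks-++ : ∀ (xs ys : List A) →
    picks (xs ++ ys) ≡ map (map₂ (_++ ys)) (picks xs) ++ map (map₂ (xs ++_)) (picks ys)
  picks-++ []       ys = sym (map-id-local (All.tabulate (λ _ → refl)))
  picks-++ (x ∷ xs) ys = cong ((x , xs ++ ys) ∷_) (begin
    map (map₂ (x ∷_)) (picks (xs ++ ys))
      ≡⟨ cong (map (map₂ (x ∷_))) (picks-++ xs ys) ⟩
    map (map₂ (x ∷_)) (map (map₂ (_++ ys)) (picks xs) ++ map (map₂ (xs ++_)) (picks ys))
      ≡⟨ map-++ (map₂ (x ∷_)) (map (map₂ (_++ ys)) (picks xs)) _ ⟩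
    map (map₂ (x ∷_)) (map (map₂ (_++ ys)) (picks xs)) ++ map (map₂ (x ∷_)) (map (map₂ (xs ++_)) (picks ys))
      ≡⟨ cong₂ _++_ (trans (sym (map-∘ (picks xs))) (map-∘ (picks xs))) (sym (map-∘ (picks ys))) ⟩
    map (map₂ (_++ ys)) (map (map₂ (x ∷_)) (picks xs)) ++ map (map₂ ((x ∷ xs) ++_)) (picks ys) ∎)
    where open ≡-Reasoning

  ∈-allVecs : ∀ {xs : List A} → (∀ x → x ∈ xs) → ∀ m (v : Vec A m) → v ∈ allVecs xs m
  ∈-allVecs h zero    []      = here refl
  ∈-allVecs h (suc m) (x ∷ v) =
    ∈-concatMap⁺ _ (lose (h x) (∈-map⁺ (x ∷_) (∈-allVecs h m v)))

  Unique-allVecs : ∀ {xs : List A} → Unique xs → ∀ m → Unique (allVecs xs m)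
  Unique-allVecs u zero    = [] ∷ []
  Unique-allVecs {xs} u (suc m) = Unique-concatMap _
    (All.tabulate (λ _ → Unique.map⁺ Vec.∷-injectiveʳ (Unique-allVecs u m)))
    (AllPairs.map disjoint u)
    where
    disjoint : ∀ {x y} → x ≢ y → Disjoint (map (x ∷_) (allVecs xs m)) (map (y ∷_) (allVecs xs m))
    disjoint x≢y (p , q) with ∈-map⁻ _ p | ∈-map⁻ _ q
    ... | _ , _ , refl | _ , _ , eq = x≢y (Vec.∷-injectiveˡ eq)

  filterᵇ-cong : ∀ {φ ψ : A → Bool} xs → (∀ {i} → i ∈ xs → φ i ≡ ψ i) → filterᵇ φ xs ≡ filterᵇ ψ xs
  filterᵇ-cong []       h = refl
  filterᵇ-cong {φ} {ψ} (x ∷ xs) h with φ x | ψ x | h (here refl)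
  ... | true  | _ | refl = cong (x ∷_) (filterᵇ-cong xs (h ∘ there))
  ... | false | _ | refl = filterᵇ-cong xs (h ∘ there)

  filterᵇ-flip : ∀ {φ ψ : A → Bool} {a} xs → Unique xs → a ∈ xs → φ a ≡ false → ψ a ≡ true →
    (∀ {i} → i ≢ a → φ i ≡ ψ i) → length (filterᵇ ψ xs) ≡ suc (length (filterᵇ φ xs))
  filterᵇ-flip {φ} {ψ} {a} (.a ∷ xs) (a∉ ∷ u) (here refl) φa ψa h
    rewrite φa | ψa = cong suc (cong length (sym (filterᵇ-cong xs (λ i∈ → h (λ { refl → All.lookup a∉ i∈ refl })))))
  filterᵇ-flip {φ} {ψ} {a} (x ∷ xs) (x∉ ∷ u) (there a∈) φa ψa h
    with φ x | ψ x | h {x} (All.lookup x∉ a∈)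
  ... | true  | _ | refl = cong suc (filterᵇ-flip xs u a∈ φa ψa h)
  ... | false | _ | refl = filterᵇ-flip xs u a∈ φa ψa h

  filterᵇ-complement : ∀ (φ : A → Bool) xs →
    length (filterᵇ φ xs) + length (filterᵇ (not ∘ φ) xs) ≡ length xs
  filterᵇ-complement φ []       = refl
  filterᵇ-complement φ (x ∷ xs) with φ x
  ... | true  = cong suc (filterᵇ-complement φ xs)
  ... | false = trans (+-suc _ _) (cong suc (filterᵇ-complement φ xs))

  filterᵇ-tabulate : ∀ {n} (S : Subset n) (φ : A → Bool) (g : Fin n → A) →
    (∀ i → φ (g i) ≡ lookup S i) → length (filterᵇ φ (tabulate g)) ≡ ∣ S ∣
  filterᵇ-tabulate []      φ g h = refl
  filterᵇ-tabulate (s ∷ S) φ g h rewrite h zero with s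
  ... | true  = cong suc (filterᵇ-tabulate S φ (g ∘ suc) (h ∘ suc))
  ... | false = filterᵇ-tabulate S φ (g ∘ suc) (h ∘ suc)

module _ {n : ℕ} where

  lookup-ext : {f g : Vec (Fin n) n} → (∀ i → lookup f i ≡ lookup g i) → f ≡ g
  lookup-ext {f} {g} h = trans (sym (Vec.tabulate∘lookup f)) (trans (Vec.tabulate-cong h) (Vec.tabulate∘lookup g))


  link unlink : Fin n → Fin n → Vec (Fin n) n → Vec (Fin n) n
  link   a b f = (f [ b ]≔ a) [ a ]≔ b
  unlink a b f = (f [ b ]≔ b) [ a ]≔ a

  -- The fixed-point-free involutions of the vertex set L, extended by the identity.
  record IsMatching (L : List (Fin n)) (f : Vec (Fin n) n) : Set where
    constructor isMatching
    field
      on  : ∀ {i} → i ∈ L → lookup f i ∈ L × lookup f i ≢ i × lookup f (lookup f i) ≡ i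
      off : ∀ {i} → i ∉ L → lookup f i ≡ i

  -- The first argument is fuel: it bounds the length of the vertex list.
  matchingsOn : ℕ → List (Fin n) → List (Vec (Fin n) n)
  matchingsOn _       []      = Vec.allFin n ∷ []
  matchingsOn zero    (_ ∷ _) = []
  matchingsOn (suc h) (a ∷ L) =
    concatMap (λ (b , L′) → map (link a b) (matchingsOn h L′)) (picks L)

  IsMatching-resp-↭ : ∀ {L L′ f} → L ↭ L′ → IsMatching L f → IsMatching L′ f
  IsMatching-resp-↭ p (isMatching on off) = isMatching
    (λ i∈ → let (x , y , z) = on (∈-resp-↭ (↭-sym p) i∈) in ∈-resp-↭ p x , y , z)
    (λ i∉ → off (i∉ ∘ ∈-resp-↭ p))

  module _ {a b : Fin n} (a≢b : a ≢ b) (f : Vec (Fin n) n) where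

    lookup-update₂-b : ∀ x y → lookup ((f [ b ]≔ x) [ a ]≔ y) b ≡ x
    lookup-update₂-b x y = trans (Vec.lookup∘update′ (a≢b ∘ sym) (f [ b ]≔ x) y) (Vec.lookup∘update b f x)

    lookup-update₂-other : ∀ x y {i} → i ≢ a → i ≢ b → lookup ((f [ b ]≔ x) [ a ]≔ y) i ≡ lookup f i
    lookup-update₂-other x y i≢a i≢b = trans (Vec.lookup∘update′ i≢a (f [ b ]≔ x) y) (Vec.lookup∘update′ i≢b f x)

  lookup-update₂-a : ∀ (a b : Fin n) (f : Vec (Fin n) n) x y → lookup ((f [ b ]≔ x) [ a ]≔ y) a ≡ y
  lookup-update₂-a a b f x y = Vec.lookup∘update a (f [ b ]≔ x) y

  module _ {a b : Fin n} {L : List (Fin n)} (a≢b : a ≢ b) (a∉L : a ∉ L) (b∉L : b ∉ L) where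

    link-isMatching : ∀ {f} → IsMatching L f → IsMatching (a ∷ b ∷ L) (link a b f)
    link-isMatching {f} (isMatching on off) = isMatching on′ off′
      where
      g = link a b f
      ga : lookup g a ≡ b
      ga = lookup-update₂-a a b f a b
      gb : lookup g b ≡ a
      gb = lookup-update₂-b a≢b f a b
      gi : ∀ {i} → i ≢ a → i ≢ b → lookup g i ≡ lookup f i
      gi = lookup-update₂-other a≢b f a b
      on′ : ∀ {i} → i ∈ a ∷ b ∷ L → lookup g i ∈ a ∷ b ∷ L × lookup g i ≢ i × lookup g (lookup g i) ≡ i
      on′ (here refl)         rewrite ga = there (here refl) , a≢b ∘ sym , gb
      on′ (there (here refl)) rewrite gb = here refl , a≢b , ga
      on′ {i} (there (there i∈)) with (x , y , z) ← on i∈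
        rewrite gi {i} (λ { refl → a∉L i∈ }) (λ { refl → b∉L i∈ }) =
        there (there x) , y ,
        trans (gi (λ eq → a∉L (subst (_∈ L) eq x)) (λ eq → b∉L (subst (_∈ L) eq x))) z
      off′ : ∀ {i} → i ∉ a ∷ b ∷ L → lookup g i ≡ i
      off′ i∉ = trans (gi (i∉ ∘ here) (i∉ ∘ there ∘ here)) (off (i∉ ∘ there ∘ there))

    unlink-isMatching : ∀ {f} → lookup f a ≡ b → IsMatching (a ∷ b ∷ L) f → IsMatching L (unlink a b f)
    unlink-isMatching {f} fa (isMatching on off) = isMatching on′ off′
      where
      g = unlink a b f
      ga : lookup g a ≡ a
      ga = lookup-update₂-a a b f b a
      gb : lookup g b ≡ b
      gb = lookup-update₂-b a≢b f b a
      gi : ∀ {i} → i ≢ a → i ≢ b → lookup g i ≡ lookup f i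
      gi = lookup-update₂-other a≢b f b a
      fb : lookup f b ≡ a
      fb = trans (cong (lookup f) (sym fa)) (proj₂ (proj₂ (on (here refl))))
      on′ : ∀ {i} → i ∈ L → lookup g i ∈ L × lookup g i ≢ i × lookup g (lookup g i) ≡ i
      on′ {i} i∈ with (x , y , z) ← on (there (there i∈))
        rewrite gi {i} (λ { refl → a∉L i∈ }) (λ { refl → b∉L i∈ }) =
        fi∈L x , y , trans (gi fi≢a fi≢b) z
        where
        fi≢a : lookup f i ≢ a
        fi≢a eq = b∉L (subst (_∈ L) (trans (sym z) (trans (cong (lookup f) eq) fa)) i∈)
        fi≢b : lookup f i ≢ b
        fi≢b eq = a∉L (subst (_∈ L) (trans (sym z) (trans (cong (lookup f) eq) fb)) i∈)
        fi∈L : lookup f i ∈ a ∷ b ∷ L → lookup f i ∈ L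
        fi∈L (here eq)          = contradiction eq fi≢a
        fi∈L (there (here eq))  = contradiction eq fi≢b
        fi∈L (there (there fi)) = fi
      off′ : ∀ {i} → i ∉ L → lookup g i ≡ i
      off′ {i} i∉ with i ≟ a | i ≟ b
      ... | yes refl | _        = ga
      ... | no _     | yes refl = gb
      ... | no i≢a   | no i≢b   = trans (gi i≢a i≢b)
        (off (λ { (here eq) → i≢a eq ; (there (here eq)) → i≢b eq ; (there (there p)) → i∉ p }))

    -- Together with `unlink-link` this makes `link a b` a bijection from the matchings of `L` to
    -- those matchings of `a ∷ b ∷ L` that pair `a` with `b`. This half gives completeness of the
    -- enumeration, the other half the absence of repetitions.
    link-unlink : ∀ {f} → lookup f a ≡ b → IsMatching (a ∷ b ∷ L) f → link a b (unlink a b f) ≡ f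
    link-unlink {f} fa (isMatching on _) = lookup-ext eq
      where
      eq : ∀ i → lookup (link a b (unlink a b f)) i ≡ lookup f i
      eq i with i ≟ a | i ≟ b
      ... | yes refl | _        = trans (lookup-update₂-a a b (unlink a b f) a b) (sym fa)
      ... | no _     | yes refl = trans (lookup-update₂-b a≢b (unlink a b f) a b)
        (trans (sym (proj₂ (proj₂ (on (here refl))))) (cong (lookup f) fa))
      ... | no i≢a   | no i≢b   = trans (lookup-update₂-other a≢b (unlink a b f) a b i≢a i≢b)
        (lookup-update₂-other a≢b f b a i≢a i≢b)

    unlink-link : ∀ {f} → IsMatching L f → unlink a b (link a b f) ≡ f
    unlink-link {f} (isMatching _ off) = lookup-ext eq
      where
      eq : ∀ i → lookup (unlink a b (link a b f)) i ≡ lookup f i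
      eq i with i ≟ a | i ≟ b
      ... | yes refl | _        = trans (lookup-update₂-a a b (link a b f) b a) (sym (off a∉L))
      ... | no _     | yes refl = trans (lookup-update₂-b a≢b (link a b f) b a) (sym (off b∉L))
      ... | no i≢a   | no i≢b   = trans (lookup-update₂-other a≢b (link a b f) b a i≢a i≢b)
        (lookup-update₂-other a≢b f a b i≢a i≢b)

  record Distinct (a b : Fin n) (L : List (Fin n)) : Set where
    constructor distinct
    field
      a≢b : a ≢ b
      a∉L : a ∉ L
      b∉L : b ∉ L
      L!  : Unique L

  picks-distinct : ∀ {a L b L′} → Unique (a ∷ L) → (b , L′) ∈ picks L → Distinct a b L′
  picks-distinct u p with Unique-resp-↭ (prep _ (picks-↭ p)) u
  ... | (a≢b ∷ a∉) ∷ (b∉ ∷ u′) = distinct a≢b (λ a∈ → All.lookup a∉ a∈ refl) (λ b∈ → All.lookup b∉ b∈ refl) u′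

  matchingsOn-sound : ∀ h L {f} → Unique L → f ∈ matchingsOn h L → IsMatching L f
  matchingsOn-sound h [] u (here refl) = isMatching (λ ()) (λ {i} _ → Vec.lookup-allFin i)
  matchingsOn-sound (suc h) (a ∷ L) u f∈
    with ((b , L′) , p , f∈′) ← find (∈-concatMap⁻ _ {xs = picks L} f∈)
    with (g , g∈ , refl) ← ∈-map⁻ (link a b) f∈′
    with distinct a≢b a∉ b∉ u′ ← picks-distinct u p =
    IsMatching-resp-↭ (prep a (↭-sym (picks-↭ p)))
      (link-isMatching a≢b a∉ b∉ (matchingsOn-sound h L′ u′ g∈))

  matchingsOn-complete : ∀ h L {f} → Unique L → length L ≤ h → IsMatching L f → f ∈ matchingsOn h L
  matchingsOn-complete h [] u _ (isMatching _ off) =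
    here (lookup-ext (λ i → trans (off (λ ())) (sym (Vec.lookup-allFin i))))
  matchingsOn-complete (suc h) (a ∷ L) {f} u (s≤s l≤h) m@(isMatching on off) with on (here refl)
  ... | here fa≡a , fa≢a , _ = contradiction fa≡a fa≢a
  ... | there fa∈L , _ , _
    with (L′ , p) ← ∈⇒picks fa∈L
    with distinct a≢b a∉ b∉ u′ ← picks-distinct u p
    with m′ ← IsMatching-resp-↭ (prep a (picks-↭ p)) m =
    ∈-concatMap⁺ _ (lose p (subst (_∈ map (link a (lookup f a)) (matchingsOn h L′))
      (link-unlink a≢b a∉ b∉ refl m′)
      (∈-map⁺ _ (matchingsOn-complete h L′ u′
        (≤-trans (≤-trans (n≤1+n _) (≤-reflexive (sym (↭-length (picks-↭ p))))) l≤h)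
        (unlink-isMatching a≢b a∉ b∉ refl m′)))))

  -- Matchings from different choices of the partner differ in their value at `a`. For a fixed
  -- partner, `unlink a b` maps the linked list back to a list that is free of repetitions by
  -- induction.
  matchingsOn-unique : ∀ h L → Unique L → Unique (matchingsOn h L)
  matchingsOn-unique h       []      u = [] ∷ []
  matchingsOn-unique zero    (a ∷ L) u = []
  matchingsOn-unique (suc h) (a ∷ L) u@(_ ∷ L!) = Unique-concatMap _
    (All.tabulate (λ {(b , L′)} p → linked (picks-distinct u p)))
    (AllPairs.map (λ {x} {y} → disjoint {x} {y}) (AllPairs.map⁻ (subst Unique (sym (map-proj₁-picks L)) L!)))
    where
    linked : ∀ {b L′} → Distinct a b L′ → Unique (map (link a b) (matchingsOn h L′))
    linked {b} {L′} (distinct a≢b a∉ b∉ u′) = Unique.map⁻ {f = unlink a b} (subst Unique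
      (sym (trans (sym (map-∘ (matchingsOn h L′)))
        (map-id-local (All.tabulate (λ f∈ → unlink-link a≢b a∉ b∉ (matchingsOn-sound h L′ u′ f∈))))))
      (matchingsOn-unique h L′ u′))
    disjoint : ∀ {x y : Fin n × List (Fin n)} → proj₁ x ≢ proj₁ y →
      Disjoint (map (link a (proj₁ x)) (matchingsOn h (proj₂ x))) (map (link a (proj₁ y)) (matchingsOn h (proj₂ y)))
    disjoint x≢y (p , q) with ∈-map⁻ _ p | ∈-map⁻ _ q
    ... | f , _ , refl | g , _ , eq = x≢y (trans (sym (lookup-update₂-a a _ f a _))
      (trans (cong (λ v → lookup v a) eq) (lookup-update₂-a a _ g a _)))

  perfectMatchings-↭ : ∀ L → Unique L → (∀ i → i ∈ L) → length L ≤ n → perfectMatchings n ↭ matchingsOn n L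
  perfectMatchings-↭ L u full l≤n = ∼bag⇒↭ (unique∧set⇒bag
    (Unique.filter⁺ (T? ∘ isMatchingᵇ) (Unique-allVecs (Unique.allFin⁺ n) n))
    (matchingsOn-unique n L u)
    (λ {f} → mk⇔ (to f) (from f)))
    where
    matched : Vec (Fin n) n → Fin n → Bool
    matched f i = not ⌊ lookup f i ≟ i ⌋ ∧ ⌊ lookup f (lookup f i) ≟ i ⌋
    to : ∀ f → f ∈ perfectMatchings n → f ∈ matchingsOn n L
    to f f∈ = matchingsOn-complete n L u l≤n
      (isMatching (λ {i} _ → full _ , test i) (λ i∉ → contradiction (full _) i∉))
      where
      test : ∀ i → lookup f i ≢ i × lookup f (lookup f i) ≡ i
      test i =
        let (x , y) = Equivalence.to (T-∧ {not ⌊ lookup f i ≟ i ⌋} {⌊ lookup f (lookup f i) ≟ i ⌋})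
                        (All.lookup (All.all⁺ (matched f) (allFin n) (proj₂ (∈-filter⁻ (T? ∘ isMatchingᵇ) {xs = allVecs (allFin n) n} f∈))) (∈-allFin i))
        in toWitnessFalse {a? = lookup f i ≟ i} x , toWitness {a? = lookup f (lookup f i) ≟ i} y
    from : ∀ f → f ∈ matchingsOn n L → f ∈ perfectMatchings n
    from f f∈ with isMatching on _ ← matchingsOn-sound n L u f∈ =
      ∈-filter⁺ (T? ∘ isMatchingᵇ) (∈-allVecs ∈-allFin n f) (All.all⁻ (matched f) (All.tabulate {xs = allFin n} (λ {i} _ →
        let (_ , x , y) = on (full i) in Equivalence.from (T-∧ {not ⌊ lookup f i ≟ i ⌋}) (fromWitnessFalse {a? = lookup f i ≟ i} x , fromWitness {a? = lookup f (lookup f i) ≟ i} y))))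

  -- Cut sizes along the enumeration

  module _ (S : Subset n) where

    private
      crossing : Vec (Fin n) n → Fin n → Bool
      crossing f i = lookup S i ∧ not (lookup S (lookup f i))

    cut-identity : cutMatching S (Vec.allFin n) ≡ 0
    cut-identity = none (allFin n)
      where
      none : ∀ xs → length (filterᵇ (crossing (Vec.allFin n)) xs) ≡ 0
      none []       = refl
      none (i ∷ xs) rewrite Vec.lookup-allFin i with lookup S i
      ... | true  = none xs
      ... | false = none xs

    -- Since `f` fixes `a` and `b`, linking two vertices on the same side leaves the side of the
    -- image of every vertex unchanged.
    cut-link-same : ∀ {a b L f} → Distinct a b L → IsMatching L f → lookup S a ≡ lookup S b →
      cutMatching S (link a b f) ≡ cutMatching S f
    cut-link-same {a} {b} {L} {f} (distinct a≢b a∉ b∉ _) (isMatching _ off) Sa≡Sb =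
      cong length (filterᵇ-cong (allFin n) (λ {i} _ → cong (λ x → lookup S i ∧ not x) (same i)))
      where
      same : ∀ i → lookup S (lookup (link a b f) i) ≡ lookup S (lookup f i)
      same i with i ≟ a | i ≟ b
      ... | yes refl | _        = trans (cong (lookup S) (lookup-update₂-a a b f a b))
        (trans (sym Sa≡Sb) (cong (lookup S) (sym (off a∉))))
      ... | no _     | yes refl = trans (cong (lookup S) (lookup-update₂-b a≢b f a b))
        (trans Sa≡Sb (cong (lookup S) (sym (off b∉))))
      ... | no i≢a   | no i≢b   = cong (lookup S) (lookup-update₂-other a≢b f a b i≢a i≢b)

    -- The new edge is counted only at its endpoint `a` in `S`. At `b` the test fails before and
    -- after, because `b` lies outside `S`.
    cut-link-cross : ∀ {a b L f} → Distinct a b L → IsMatching L f → lookup S a ≡ true → lookup S b ≡ false →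
      cutMatching S (link a b f) ≡ suc (cutMatching S f)
    cut-link-cross {a} {b} {L} {f} (distinct a≢b a∉ b∉ _) (isMatching _ off) Sa Sb =
      filterᵇ-flip (allFin n) (Unique.allFin⁺ n) (∈-allFin a) at-a at-a′ (λ {i} → other i)
      where
      at-a : crossing f a ≡ false
      at-a = cong₂ (λ x y → x ∧ not y) Sa (trans (cong (lookup S) (off a∉)) Sa)
      at-a′ : crossing (link a b f) a ≡ true
      at-a′ = cong₂ (λ x y → x ∧ not y) Sa (trans (cong (lookup S) (lookup-update₂-a a b f a b)) Sb)
      other : ∀ i → i ≢ a → crossing f i ≡ crossing (link a b f) i
      other i i≢a with i ≟ b
      ... | yes refl = trans (cong (_∧ not (lookup S (lookup f b))) Sb) (cong (_∧ not (lookup S (lookup (link a b f) b))) (sym Sb))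
      ... | no i≢b   = cong (λ j → lookup S i ∧ not (lookup S j)) (sym (lookup-update₂-other a≢b f a b i≢a i≢b))

    cuts-0-suc : ∀ t → cuts 0 (suc t) ≡ copies t (cuts 0 (pred t))
    cuts-0-suc zero    = refl
    cuts-0-suc (suc t) = refl

    -- The clause for `cuts 1` fits the general recursion because it has zero internal partners;
    -- likewise `pred 0` is harmless, as it occurs only under zero copies.
    cuts-suc : ∀ s t → cuts (suc s) t ≡ copies s (cuts (pred s) t) ++ copies t (map suc (cuts s (pred t)))
    cuts-suc zero    t = refl
    cuts-suc (suc s) t = refl

    -- After the first vertex and its partner are removed, the remaining cut sizes depend only on
    -- how many vertices are left on each side. An equality of lists holds, not just a permutation,
    -- because `cuts` lists internal partners before crossing ones, the order in which `matchingsOn`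
    -- meets them.
    cuts-matchingsOn : ∀ h Ls Lt → All (λ i → lookup S i ≡ true) Ls → All (λ i → lookup S i ≡ false) Lt →
      Unique (Ls ++ Lt) → length (Ls ++ Lt) ≤ h →
      map (cutMatching S) (matchingsOn h (Ls ++ Lt)) ≡ cuts (length Ls) (length Lt)
    cuts-matchingsOn h [] [] _ _ _ _ = cong (_∷ []) cut-identity
    cuts-matchingsOn (suc h) [] (a ∷ Lt) _ (Sa ∷ St) u (s≤s l≤h) = begin
      map (cutMatching S) (matchingsOn (suc h) (a ∷ Lt))
        ≡⟨ map-concatMap-const (cutMatching S) _ (picks Lt) each ⟩
      copies (length (picks Lt)) (cuts 0 (pred (length Lt)))
        ≡⟨ cong (λ l → copies l (cuts 0 (pred (length Lt)))) (length-picks Lt) ⟩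
      copies (length Lt) (cuts 0 (pred (length Lt)))
        ≡⟨ cuts-0-suc (length Lt) ⟨
      cuts 0 (suc (length Lt)) ∎
      where
      open ≡-Reasoning
      each : ∀ {x} → x ∈ picks Lt →
        map (cutMatching S) (map (link a (proj₁ x)) (matchingsOn h (proj₂ x))) ≡ cuts 0 (pred (length Lt))
      each {b , L′} p with Sb ∷ St′ ← All-resp-↭ (picks-↭ p) St
        with D@(distinct _ _ _ u′) ← picks-distinct u p = begin
        map (cutMatching S) (map (link a b) (matchingsOn h L′))
          ≡⟨ map-∘ (matchingsOn h L′) ⟨
        map (cutMatching S ∘ link a b) (matchingsOn h L′)
          ≡⟨ map-cong-local (All.tabulate (λ f∈ → cut-link-same D (matchingsOn-sound h L′ u′ f∈) (trans Sa (sym Sb)))) ⟩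
        map (cutMatching S) (matchingsOn h L′)
          ≡⟨ cuts-matchingsOn h [] L′ [] St′ u′ (≤-trans (≤-trans (n≤1+n _) (≤-reflexive (sym (↭-length (picks-↭ p))))) l≤h) ⟩
        cuts 0 (length L′)
          ≡⟨ cong (cuts 0 ∘ pred) (sym (↭-length (picks-↭ p))) ⟩
        cuts 0 (pred (length Lt)) ∎
    cuts-matchingsOn (suc h) (a ∷ Ls) Lt (Sa ∷ Ss) St u (s≤s l≤h) = begin
      map (cutMatching S) (concatMap g (picks (Ls ++ Lt)))
        ≡⟨ cong (map (cutMatching S) ∘ concatMap g) (picks-++ Ls Lt) ⟩
      map (cutMatching S) (concatMap g (map (map₂ (_++ Lt)) (picks Ls) ++ map (map₂ (Ls ++_)) (picks Lt)))
        ≡⟨ cong (map (cutMatching S)) (trans (concatMap-++ g (map (map₂ (_++ Lt)) (picks Ls)) _)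
             (cong₂ _++_ (concatMap-map g (map₂ (_++ Lt)) (picks Ls)) (concatMap-map g (map₂ (Ls ++_)) (picks Lt)))) ⟩
      map (cutMatching S) (concatMap (g ∘ map₂ (_++ Lt)) (picks Ls) ++ concatMap (g ∘ map₂ (Ls ++_)) (picks Lt))
        ≡⟨ map-++ (cutMatching S) (concatMap (g ∘ map₂ (_++ Lt)) (picks Ls)) _ ⟩
      map (cutMatching S) (concatMap (g ∘ map₂ (_++ Lt)) (picks Ls)) ++ map (cutMatching S) (concatMap (g ∘ map₂ (Ls ++_)) (picks Lt))
        ≡⟨ cong₂ _++_ (map-concatMap-const (cutMatching S) _ (picks Ls) internal) (map-concatMap-const (cutMatching S) _ (picks Lt) cross) ⟩
      copies (length (picks Ls)) (cuts (pred (length Ls)) (length Lt)) ++ copies (length (picks Lt)) (map suc (cuts (length Ls) (pred (length Lt))))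
        ≡⟨ cong₂ (λ x y → copies x (cuts (pred (length Ls)) (length Lt)) ++ copies y (map suc (cuts (length Ls) (pred (length Lt))))) (length-picks Ls) (length-picks Lt) ⟩
      copies (length Ls) (cuts (pred (length Ls)) (length Lt)) ++ copies (length Lt) (map suc (cuts (length Ls) (pred (length Lt))))
        ≡⟨ cuts-suc (length Ls) (length Lt) ⟨
      cuts (suc (length Ls)) (length Lt) ∎
      where
      open ≡-Reasoning
      g : Fin n × List (Fin n) → List (Vec (Fin n) n)
      g (b , L′) = map (link a b) (matchingsOn h L′)
      fuel : ∀ {b L′} → (b , L′) ∈ picks (Ls ++ Lt) → length L′ ≤ h
      fuel p = ≤-trans (≤-trans (n≤1+n _) (≤-reflexive (sym (↭-length (picks-↭ p))))) l≤h
      internal : ∀ {x} → x ∈ picks Ls →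
        map (cutMatching S) (g (map₂ (_++ Lt) x)) ≡ cuts (pred (length Ls)) (length Lt)
      internal {b , l} p with Sb ∷ Ss′ ← All-resp-↭ (picks-↭ p) Ss
        with p′ ← subst ((b , l ++ Lt) ∈_) (sym (picks-++ Ls Lt)) (∈-++⁺ˡ (∈-map⁺ (map₂ (_++ Lt)) p))
        with D@(distinct _ _ _ u′) ← picks-distinct u p′ = begin
        map (cutMatching S) (map (link a b) (matchingsOn h (l ++ Lt)))
          ≡⟨ map-∘ (matchingsOn h (l ++ Lt)) ⟨
        map (cutMatching S ∘ link a b) (matchingsOn h (l ++ Lt))
          ≡⟨ map-cong-local (All.tabulate (λ f∈ → cut-link-same D (matchingsOn-sound h (l ++ Lt) u′ f∈) (trans Sa (sym Sb)))) ⟩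
        map (cutMatching S) (matchingsOn h (l ++ Lt))
          ≡⟨ cuts-matchingsOn h l Lt Ss′ St u′ (fuel p′) ⟩
        cuts (length l) (length Lt)
          ≡⟨ cong (λ x → cuts (pred x) (length Lt)) (sym (↭-length (picks-↭ p))) ⟩
        cuts (pred (length Ls)) (length Lt) ∎
      cross : ∀ {x} → x ∈ picks Lt →
        map (cutMatching S) (g (map₂ (Ls ++_) x)) ≡ map suc (cuts (length Ls) (pred (length Lt)))
      cross {b , l} p with Sb ∷ St′ ← All-resp-↭ (picks-↭ p) St
        with p′ ← subst ((b , Ls ++ l) ∈_) (sym (picks-++ Ls Lt)) (∈-++⁺ʳ (map (map₂ (_++ Lt)) (picks Ls)) (∈-map⁺ (map₂ (Ls ++_)) p))
        with D@(distinct _ _ _ u′) ← picks-distinct u p′ = begin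
        map (cutMatching S) (map (link a b) (matchingsOn h (Ls ++ l)))
          ≡⟨ map-∘ (matchingsOn h (Ls ++ l)) ⟨
        map (cutMatching S ∘ link a b) (matchingsOn h (Ls ++ l))
          ≡⟨ map-cong-local (All.tabulate (λ f∈ → cut-link-cross D (matchingsOn-sound h (Ls ++ l) u′ f∈) Sa Sb)) ⟩
        map (suc ∘ cutMatching S) (matchingsOn h (Ls ++ l))
          ≡⟨ map-∘ (matchingsOn h (Ls ++ l)) ⟩
        map suc (map (cutMatching S) (matchingsOn h (Ls ++ l)))
          ≡⟨ cong (map suc) (cuts-matchingsOn h Ls l Ss St′ u′ (fuel p′)) ⟩
        map suc (cuts (length Ls) (length l))
          ≡⟨ cong (λ x → map suc (cuts (length Ls) (pred x))) (sym (↭-length (picks-↭ p))) ⟩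
        map suc (cuts (length Ls) (pred (length Lt))) ∎

    cuts-perfectMatchings : ∀ {s t} → ∣ S ∣ ≡ s → s + t ≡ n →
      map (cutMatching S) (perfectMatchings n) ↭ cuts s t
    cuts-perfectMatchings {s} {t} ∣S∣≡s s+t≡n = subst (map (cutMatching S) (perfectMatchings n) ↭_)
      (trans (cuts-matchingsOn n Ls Lt
        (All.map (Equivalence.to T-≡) (All.all-filter (T? ∘ lookup S) (allFin n)))
        (All.map (Equivalence.to T-not-≡) (All.all-filter (T? ∘ not ∘ lookup S) (allFin n)))
        L! (≤-reflexive lenL))
        (cong₂ cuts lenLs lenLt))
      (↭-map⁺ (cutMatching S) (perfectMatchings-↭ (Ls ++ Lt) L! full (≤-reflexive lenL)))
      where
      Ls = filterᵇ (lookup S) (allFin n)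
      Lt = filterᵇ (not ∘ lookup S) (allFin n)
      lenLs : length Ls ≡ s
      lenLs = trans (filterᵇ-tabulate S (lookup S) (λ i → i) (λ _ → refl)) ∣S∣≡s
      lens : length Ls + length Lt ≡ n
      lens = trans (filterᵇ-complement (lookup S) (allFin n)) (length-tabulate {n = n} (λ i → i))
      lenL : length (Ls ++ Lt) ≡ n
      lenL = trans (length-++ Ls) lens
      lenLt : length Lt ≡ t
      lenLt = +-cancelˡ-≡ s _ _ (trans (cong (_+ length Lt) (sym lenLs)) (trans lens (sym s+t≡n)))
      L! : Unique (Ls ++ Lt)
      L! = Unique.++⁺ (Unique.filter⁺ (T? ∘ lookup S) (Unique.allFin⁺ n)) (Unique.filter⁺ (T? ∘ not ∘ lookup S) (Unique.allFin⁺ n))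
        (λ {i} (p , q) → separate i (proj₂ (∈-filter⁻ (T? ∘ lookup S) {xs = allFin n} p)) (proj₂ (∈-filter⁻ (T? ∘ not ∘ lookup S) {xs = allFin n} q)))
        where
        separate : ∀ i → T (lookup S i) → ¬ T (not (lookup S i))
        separate i with lookup S i
        ... | true  = λ _ ()
        ... | false = λ ()
      full : ∀ i → i ∈ Ls ++ Lt
      full i with lookup S i in eq
      ... | true  = ∈-++⁺ˡ (∈-filter⁺ (T? ∘ lookup S) (∈-allFin i) (Equivalence.from T-≡ eq))
      ... | false = ∈-++⁺ʳ Ls (∈-filter⁺ (T? ∘ not ∘ lookup S) (∈-allFin i) (Equivalence.from T-not-≡ eq))

open ≤-Reasoning

-- Elementary inequalities

^-distribʳ-* : ∀ m n o → (m * n) ^ o ≡ m ^ o * n ^ o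
^-distribʳ-* m n zero    = refl
^-distribʳ-* m n (suc o) = begin-equality
  m * n * (m * n) ^ o       ≡⟨ cong (m * n *_) (^-distribʳ-* m n o) ⟩
  m * n * (m ^ o * n ^ o)   ≡⟨ lemma m n (m ^ o) (n ^ o) ⟩
  m * m ^ o * (n * n ^ o)   ∎
  where
  lemma : ∀ a b x y → a * b * (x * y) ≡ a * x * (b * y)
  lemma = solve-∀

^-cancelˡ-≤ : ∀ o .{{_ : NonZero o}} {m n} → m ^ o ≤ n ^ o → m ≤ n
^-cancelˡ-≤ o {m} {n} mᵒ≤nᵒ with m ≤? n
... | yes m≤n = m≤n
... | no  m≰n = contradiction mᵒ≤nᵒ (<⇒≱ (^-monoˡ-< o (≰⇒> m≰n)))

2xy≤x²+y² : ∀ x y → x * y + x * y ≤ x * x + y * y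
2xy≤x²+y² x y with ≤-total x y
... | inj₁ x≤y with (z , refl) ← m≤n⇒∃[o]m+o≡n x≤y =
  ≤-trans (m≤m+n _ (z * z)) (≤-reflexive (lemma x z))
  where
  lemma : ∀ x z → x * (x + z) + x * (x + z) + z * z ≡ x * x + (x + z) * (x + z)
  lemma = solve-∀
... | inj₂ y≤x with (z , refl) ← m≤n⇒∃[o]m+o≡n y≤x =
  ≤-trans (m≤m+n _ (z * z)) (≤-reflexive (lemma y z))
  where
  lemma : ∀ y z → (y + z) * y + (y + z) * y + z * z ≡ (y + z) * (y + z) + y * y
  lemma = solve-∀

-- Bernoulli's inequality (x/y)ʲ ≥ 1 + j (x/y − 1), valid on both sides of x = y.
bernoulli : ∀ x y j → y ^ j * (y + j * x) ≤ x ^ j * y + j * (y * y ^ j)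
bernoulli x y zero    = ≤-reflexive (lemma y)
  where
  lemma : ∀ y → 1 * (y + 0 * 0) ≡ 1 * y + 0 * (y * 1)
  lemma = solve-∀
bernoulli x y (suc j) = step (x ^ j) (y ^ j) (bernoulli x y j)
  where
  lemma₁ : ∀ x y j Y → y * Y * (y + suc j * x) + j * x * y * Y ≡ Y * (y * y + x * y) + j * Y * (x * y + x * y)
  lemma₁ = solve-∀
  lemma₂ : ∀ x y j Y → Y * (y * y + x * y) + j * Y * (x * x + y * y) ≡ x * (Y * (y + j * x)) + suc j * (y * (y * Y))
  lemma₂ = solve-∀
  lemma₃ : ∀ x y j X Y → x * (X * y + j * (y * Y)) + suc j * (y * (y * Y)) ≡ x * X * y + suc j * (y * (y * Y)) + j * x * y * Y
  lemma₃ = solve-∀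
  step : ∀ X Y → Y * (y + j * x) ≤ X * y + j * (y * Y) →
         y * Y * (y + suc j * x) ≤ x * X * y + suc j * (y * (y * Y))
  step X Y ih = +-cancelʳ-≤ (j * x * y * Y) _ _ (begin
    y * Y * (y + suc j * x) + j * x * y * Y
      ≡⟨ lemma₁ x y j Y ⟩
    Y * (y * y + x * y) + j * Y * (x * y + x * y)
      ≤⟨ +-monoʳ-≤ (Y * (y * y + x * y)) (*-monoʳ-≤ (j * Y) (2xy≤x²+y² x y)) ⟩
    Y * (y * y + x * y) + j * Y * (x * x + y * y)
      ≡⟨ lemma₂ x y j Y ⟩
    x * (Y * (y + j * x)) + suc j * (y * (y * Y))
      ≤⟨ +-monoˡ-≤ (suc j * (y * (y * Y))) (*-monoʳ-≤ x ih) ⟩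
    x * (X * y + j * (y * Y)) + suc j * (y * (y * Y))
      ≡⟨ lemma₃ x y j X Y ⟩
    x * X * y + suc j * (y * (y * Y)) + j * x * y * Y ∎)

[1+x]^j≥1+jx : ∀ x y j → y ^ j * (y + j * x) ≤ (y + x) ^ j * y
[1+x]^j≥1+jx x y j = +-cancelʳ-≤ (j * (y * y ^ j)) _ _ (begin
  y ^ j * (y + j * x) + j * (y * y ^ j) ≡⟨ lemma x y j (y ^ j) ⟩
  y ^ j * (y + j * (y + x))             ≤⟨ bernoulli (y + x) y j ⟩
  (y + x) ^ j * y + j * (y * y ^ j)     ∎)
  where
  lemma : ∀ x y j Y → Y * (y + j * x) + j * (y * Y) ≡ Y * (y + j * (y + x))
  lemma = solve-∀

-- Powers of p/q, where p/q = 1 + (c/b − 1)/N, serve as a rational substitute for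
-- the exponential function.
module _ (b c N p q : ℕ) (q≡bN : q ≡ b * N) (p+b≡q+c : p + b ≡ q + c) where

  -- The analogue of exp(x) ≥ 1 + x: Bernoulli for p/q, where p - q = c - b. The negative term is
  -- moved to the other side, so that c may lie below b.
  surrogate-≥ : ∀ j → q ^ j * (q + j * c) ≤ p ^ j * q + j * b * q ^ j
  surrogate-≥ j = +-cancelʳ-≤ (j * (q * q ^ j)) _ _ (begin
    q ^ j * (q + j * c) + j * (q * q ^ j)           ≡⟨ lemma₁ q j c (q ^ j) ⟩
    q ^ j * q + j * q ^ j * (q + c)                 ≡⟨ cong (λ x → q ^ j * q + j * q ^ j * x) (sym p+b≡q+c) ⟩
    q ^ j * q + j * q ^ j * (p + b)                 ≡⟨ lemma₂ p q b j (q ^ j) ⟩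
    q ^ j * (q + j * p) + j * b * q ^ j             ≤⟨ +-monoˡ-≤ (j * b * q ^ j) (bernoulli p q j) ⟩
    p ^ j * q + j * (q * q ^ j) + j * b * q ^ j     ≡⟨ lemma₃ (p ^ j * q) (j * (q * q ^ j)) (j * b * q ^ j) ⟩
    p ^ j * q + j * b * q ^ j + j * (q * q ^ j)     ∎)
    where
    lemma₁ : ∀ q j c Q → Q * (q + j * c) + j * (q * Q) ≡ Q * q + j * Q * (q + c)
    lemma₁ = solve-∀
    lemma₂ : ∀ p q b j Q → Q * q + j * Q * (p + b) ≡ Q * (q + j * p) + j * b * Q
    lemma₂ = solve-∀
    lemma₃ : ∀ x y z → x + y + z ≡ x + z + y
    lemma₃ = solve-∀

  -- The analogue of exp(y) ≤ (1 + y)^(1 + y) in the form exp(y/(1 + y)) ≤ 1 + y, with 1 + y = c/b.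
  -- It is Bernoulli for the inverse ratio q/p; what remains is (c - b) p ≥ (c - b) q, true for
  -- either sign because p - q = c - b.
  surrogate-≤ : ∀ L → N ≡ c * L → .{{_ : NonZero p}} → b * p ^ (b * L) ≤ c * q ^ (b * L)
  surrogate-≤ L refl = *-cancelʳ-≤ _ _ p (core (p ^ (b * L)) (q ^ (b * L)) (bernoulli q p (b * L)))
    where
    pb+qp≤cp+qq : p * b + q * p ≤ c * p + q * q
    pb+qp≤cp+qq = +-cancelʳ-≤ (p * (p + b)) _ _ (begin
      p * b + q * p + p * (p + b)     ≡⟨ cong (λ z → p * b + q * p + p * z) p+b≡q+c ⟩
      p * b + q * p + p * (q + c)     ≡⟨ lemma₁ b c p q ⟩
      p * b + c * p + (p * q + p * q) ≤⟨ +-monoʳ-≤ (p * b + c * p) (2xy≤x²+y² p q) ⟩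
      p * b + c * p + (p * p + q * q) ≡⟨ lemma₂ b c p q ⟩
      c * p + q * q + p * (p + b)     ∎)
      where
      lemma₁ : ∀ b c p q → p * b + q * p + p * (q + c) ≡ p * b + c * p + (p * q + p * q)
      lemma₁ = solve-∀
      lemma₂ : ∀ b c p q → p * b + c * p + (p * p + q * q) ≡ c * p + q * q + p * (p + b)
      lemma₂ = solve-∀
    lemma₃ : ∀ b c L p X → b * X * p + c * (b * L * (p * X)) ≡ X * (p * b + (b * (c * L)) * p)
    lemma₃ = solve-∀
    lemma₄ : ∀ b c L p q X → X * (c * p + (b * (c * L)) * q) ≡ c * (X * (p + b * L * q))
    lemma₄ = solve-∀
    lemma₅ : ∀ b c L p X Y → c * (Y * p + b * L * (p * X)) ≡ c * Y * p + c * (b * L * (p * X))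
    lemma₅ = solve-∀
    core : ∀ X Y → X * (p + b * L * q) ≤ Y * p + b * L * (p * X) → b * X * p ≤ c * Y * p
    core X Y h = +-cancelʳ-≤ (c * (b * L * (p * X))) _ _ (begin
      b * X * p + c * (b * L * (p * X))      ≡⟨ lemma₃ b c L p X ⟩
      X * (p * b + (b * (c * L)) * p)        ≡⟨ cong (λ z → X * (p * b + z * p)) (sym q≡bN) ⟩
      X * (p * b + q * p)                    ≤⟨ *-monoʳ-≤ X pb+qp≤cp+qq ⟩
      X * (c * p + q * q)                    ≡⟨ cong (λ z → X * (c * p + z * q)) q≡bN ⟩
      X * (c * p + (b * (c * L)) * q)        ≡⟨ lemma₄ b c L p q X ⟩
      c * (X * (p + b * L * q))              ≤⟨ *-monoʳ-≤ c h ⟩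
      c * (Y * p + b * L * (p * X))          ≡⟨ lemma₅ b c L p X Y ⟩
      c * Y * p + c * (b * L * (p * X))      ∎)

-- Let p = (1+u)/(2+u+v) be the probability that the exposed edge is internal, and
-- q = u/(u+v), y = c/b − 1. The hypotheses are eP/eQ ≥ 1 + y q and
-- gP/gQ ≥ 1 + y p (1 − q), and p (1 + y) eQ/eP + (1 − p) ≤ gP/gQ follows from
-- 1 + y ≤ (1 + y q) (1 + y (1 − q)), for y of either sign.
exposure-step : ∀ b c u v eP eQ gP gQ → .{{_ : NonZero b}} → .{{_ : NonZero (u + v)}} →
  eQ * (v * b + u * c) ≤ (u + v) * b * eP →
  gQ * ((1 + v) * (u + v) * b + (1 + u) * (u * b + v * c)) ≤ (2 + (u + v)) * (u + v) * b * gP →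
  (1 + u) * c * eQ * gQ + (1 + v) * b * eP * gQ ≤ (2 + (u + v)) * b * eP * gP
exposure-step b c u v eP eQ gP gQ h₁ h₂ =
  *-cancelˡ-≤ b (*-cancelˡ-≤ (u + v) (*-cancelˡ-≤ (u + v) (begin
    (u + v) * ((u + v) * (b * ((1 + u) * c * eQ * gQ + (1 + v) * b * eP * gQ)))
      ≡⟨ lemma₁ b c u v eP eQ gQ ⟩
    (1 + u) * gQ * eQ * ((u * u + v * v) * (b * c) + u * v * (b * c + b * c)) + (u + v) * b * ((1 + v) * (u + v) * b * eP * gQ)
      ≤⟨ +-monoˡ-≤ _ (*-monoʳ-≤ ((1 + u) * gQ * eQ) (+-monoʳ-≤ ((u * u + v * v) * (b * c)) (*-monoʳ-≤ (u * v) (2xy≤x²+y² b c)))) ⟩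
    (1 + u) * gQ * eQ * ((u * u + v * v) * (b * c) + u * v * (b * b + c * c)) + (u + v) * b * ((1 + v) * (u + v) * b * eP * gQ)
      ≡⟨ lemma₂ b c u v eP eQ gQ ⟩
    (1 + u) * gQ * (u * b + v * c) * (eQ * (v * b + u * c)) + (u + v) * b * ((1 + v) * (u + v) * b * eP * gQ)
      ≤⟨ +-monoˡ-≤ _ (*-monoʳ-≤ ((1 + u) * gQ * (u * b + v * c)) h₁) ⟩
    (1 + u) * gQ * (u * b + v * c) * ((u + v) * b * eP) + (u + v) * b * ((1 + v) * (u + v) * b * eP * gQ)
      ≡⟨ lemma₃ b c u v eP gQ ⟩
    (u + v) * b * eP * (gQ * ((1 + v) * (u + v) * b + (1 + u) * (u * b + v * c)))
      ≤⟨ *-monoʳ-≤ ((u + v) * b * eP) h₂ ⟩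
    (u + v) * b * eP * ((2 + (u + v)) * (u + v) * b * gP)
      ≡⟨ lemma₄ b (u + v) eP gP ⟩
    (u + v) * ((u + v) * (b * ((2 + (u + v)) * b * eP * gP))) ∎)))
  where
  lemma₁ : ∀ b c u v eP eQ gQ →
    (u + v) * ((u + v) * (b * ((1 + u) * c * eQ * gQ + (1 + v) * b * eP * gQ))) ≡
    (1 + u) * gQ * eQ * ((u * u + v * v) * (b * c) + u * v * (b * c + b * c)) + (u + v) * b * ((1 + v) * (u + v) * b * eP * gQ)
  lemma₁ = solve-∀
  lemma₂ : ∀ b c u v eP eQ gQ →
    (1 + u) * gQ * eQ * ((u * u + v * v) * (b * c) + u * v * (b * b + c * c)) + (u + v) * b * ((1 + v) * (u + v) * b * eP * gQ) ≡
    (1 + u) * gQ * (u * b + v * c) * (eQ * (v * b + u * c)) + (u + v) * b * ((1 + v) * (u + v) * b * eP * gQ)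
  lemma₂ = solve-∀
  lemma₃ : ∀ b c u v eP gQ →
    (1 + u) * gQ * (u * b + v * c) * ((u + v) * b * eP) + (u + v) * b * ((1 + v) * (u + v) * b * eP * gQ) ≡
    (u + v) * b * eP * (gQ * ((1 + v) * (u + v) * b + (1 + u) * (u * b + v * c)))
  lemma₃ = solve-∀
  lemma₄ : ∀ b m eP gP → m * b * eP * ((2 + m) * m * b * gP) ≡ m * (m * (b * ((2 + m) * b * eP * gP)))
  lemma₄ = solve-∀

-- The moment generating function of a single matching

module _ {A : Set} where

  sum-map-*ˡ : ∀ a (f : A → ℕ) xs → sum (map (λ x → a * f x) xs) ≡ a * sum (map f xs)
  sum-map-*ˡ a f []       = sym (*-zeroʳ a)
  sum-map-*ˡ a f (x ∷ xs) =
    trans (cong (a * f x +_) (sum-map-*ˡ a f xs)) (sym (*-distribˡ-+ a (f x) _))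

  sum-map-++ : ∀ (f : A → ℕ) xs ys → sum (map f (xs ++ ys)) ≡ sum (map f xs) + sum (map f ys)
  sum-map-++ f xs ys = trans (cong sum (map-++ f xs ys)) (sum-++ (map f xs) (map f ys))

  sum-map-copies : ∀ (f : A → ℕ) k xs → sum (map f (copies k xs)) ≡ k * sum (map f xs)
  sum-map-copies f zero    xs = refl
  sum-map-copies f (suc k) xs =
    trans (sum-map-++ f xs (copies k xs)) (cong (sum (map f xs) +_) (sum-map-copies f k xs))

  length-copies : ∀ k (xs : List A) → length (copies k xs) ≡ k * length xs
  length-copies zero    xs = refl
  length-copies (suc k) xs =
    trans (length-++ xs) (cong (length xs +_) (length-copies k xs))

  All-copies : ∀ {P : A → Set} k {xs} → All P xs → All P (copies k xs)
  All-copies k pxs = All.concat⁺ (All.replicate⁺ k pxs)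

sum-map-suc : ∀ (xs : List ℕ) → sum (map suc xs) ≡ length xs + sum xs
sum-map-suc []       = refl
sum-map-suc (x ∷ xs) = begin-equality
  suc x + sum (map suc xs)        ≡⟨ cong (suc x +_) (sum-map-suc xs) ⟩
  suc x + (length xs + sum xs)    ≡⟨ lemma x (length xs) (sum xs) ⟩
  suc (length xs) + (x + sum xs)  ∎
  where
  lemma : ∀ x l m → suc x + (l + m) ≡ suc l + (x + m)
  lemma = solve-∀

sum-copies : ∀ k xs → sum (copies k xs) ≡ k * sum xs
sum-copies zero    xs = refl
sum-copies (suc k) xs = trans (sum-++ xs (copies k xs)) (cong (sum xs +_) (sum-copies k xs))

length-cuts : ∀ s t → length (cuts s t) ≡ matchings# (s + t)
length-cuts 0 0 = refl
length-cuts 0 1 = refl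
length-cuts 0 (suc (suc t)) =
  trans (length-copies (suc t) (cuts 0 t)) (cong (suc t *_) (length-cuts 0 t))
length-cuts 1 0 = refl
length-cuts 1 (suc t) = trans (length-copies (suc t) (map suc (cuts 0 t)))
  (cong (suc t *_) (trans (length-map suc (cuts 0 t)) (length-cuts 0 t)))
length-cuts (suc (suc s)) t = begin-equality
  length (copies (suc s) (cuts s t) ++ copies t (map suc (cuts (suc s) (pred t))))
    ≡⟨ length-++ (copies (suc s) (cuts s t)) ⟩
  length (copies (suc s) (cuts s t)) + length (copies t (map suc (cuts (suc s) (pred t))))
    ≡⟨ cong₂ _+_ (length-copies (suc s) (cuts s t)) (length-copies t _) ⟩
  suc s * length (cuts s t) + t * length (map suc (cuts (suc s) (pred t)))
    ≡⟨ cong₂ (λ x y → suc s * x + t * y) (length-cuts s t) (length-map suc (cuts (suc s) (pred t))) ⟩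
  suc s * matchings# (s + t) + t * length (cuts (suc s) (pred t))
    ≡⟨ cong (suc s * matchings# (s + t) +_) (cross t) ⟩
  suc s * matchings# (s + t) + t * matchings# (s + t)
    ≡⟨ *-distribʳ-+ (matchings# (s + t)) (suc s) t ⟨
  (suc s + t) * matchings# (s + t) ∎
  where
  cross : ∀ t → t * length (cuts (suc s) (pred t)) ≡ t * matchings# (s + t)
  cross zero    = refl
  cross (suc t) = cong (suc t *_)
    (trans (length-cuts (suc s) t) (cong matchings# (sym (+-suc s t))))

cuts-0≡0 : ∀ t → All (_≡ 0) (cuts 0 t)
cuts-0≡0 0             = refl ∷ []
cuts-0≡0 1             = []
cuts-0≡0 (suc (suc t)) = All-copies (suc t) (cuts-0≡0 t)

sum-cuts-0 : ∀ t → sum (cuts 0 t) ≡ 0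
sum-cuts-0 0 = refl
sum-cuts-0 1 = refl
sum-cuts-0 (suc (suc t)) =
  trans (sum-copies (suc t) (cuts 0 t)) (trans (cong (suc t *_) (sum-cuts-0 t)) (*-zeroʳ (suc t)))

matchings#-suc : ∀ m → matchings# (suc m) ≡ m * matchings# (pred m)
matchings#-suc zero    = refl
matchings#-suc (suc m) = refl

-- Each of the `s * t` pairs across the boundary is an edge of `matchings# (s + t - 2)` matchings.
-- The count is carried along the recursion for `cuts`.
sum-cuts : ∀ s t → sum (cuts s t) ≡ s * t * matchings# (pred (pred (s + t)))
sum-cuts 0 t = sum-cuts-0 t
sum-cuts 1 t = begin-equality
  sum (copies t (map suc (cuts 0 (pred t))))                 ≡⟨ sum-copies t _ ⟩
  t * sum (map suc (cuts 0 (pred t)))                        ≡⟨ cong (t *_) (sum-map-suc (cuts 0 (pred t))) ⟩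
  t * (length (cuts 0 (pred t)) + sum (cuts 0 (pred t)))     ≡⟨ cong₂ (λ x y → t * (x + y)) (length-cuts 0 (pred t)) (sum-cuts-0 (pred t)) ⟩
  t * (matchings# (pred t) + 0)                              ≡⟨ lemma t (matchings# (pred t)) ⟩
  1 * t * matchings# (pred t)                                ∎
  where
  lemma : ∀ t m → t * (m + 0) ≡ 1 * t * m
  lemma = solve-∀
sum-cuts (suc (suc s)) t = begin-equality
  sum (copies (suc s) (cuts s t) ++ copies t (map suc (cuts (suc s) (pred t))))
    ≡⟨ sum-++ (copies (suc s) (cuts s t)) _ ⟩
  sum (copies (suc s) (cuts s t)) + sum (copies t (map suc (cuts (suc s) (pred t))))
    ≡⟨ cong₂ _+_ (sum-copies (suc s) (cuts s t)) (sum-copies t _) ⟩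
  suc s * sum (cuts s t) + t * sum (map suc (cuts (suc s) (pred t)))
    ≡⟨ cong₂ (λ x y → suc s * x + t * y) (sum-cuts s t) (sum-map-suc (cuts (suc s) (pred t))) ⟩
  suc s * (s * t * matchings# (pred (pred (s + t)))) + t * (length (cuts (suc s) (pred t)) + sum (cuts (suc s) (pred t)))
    ≡⟨ cong₂ (λ x y → suc s * (s * t * matchings# (pred (pred (s + t)))) + t * (x + y)) (length-cuts (suc s) (pred t)) (sum-cuts (suc s) (pred t)) ⟩
  suc s * (s * t * matchings# (pred (pred (s + t)))) + t * (matchings# (suc s + pred t) + suc s * pred t * matchings# (pred (s + pred t)))
    ≡⟨ step t ⟩
  suc (suc s) * t * matchings# (s + t) ∎
  where
  lemma₁ : ∀ s m m′ m″ k → suc s * (s * 0 * m) + 0 * (m′ + suc s * 0 * m″) ≡ suc (suc s) * 0 * k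
  lemma₁ = solve-∀
  lemma₂ : ∀ s t m → suc s * (s * suc t * m) + suc t * ((s + t) * m + suc s * t * m)
                     ≡ suc (suc s) * suc t * ((s + t) * m)
  lemma₂ = solve-∀
  step : ∀ t → suc s * (s * t * matchings# (pred (pred (s + t)))) + t * (matchings# (suc s + pred t) + suc s * pred t * matchings# (pred (s + pred t)))
        ≡ suc (suc s) * t * matchings# (s + t)
  step zero    = lemma₁ s (matchings# (pred (pred (s + 0)))) (matchings# (suc s + 0)) (matchings# (pred (s + 0))) (matchings# (s + 0))
  step (suc t) rewrite +-suc s t | matchings#-suc (s + t) = lemma₂ s t (matchings# (pred (s + t)))

-- Vertices of `S` that are not cut come in matched pairs, so the halving in `weight` is exact.
cuts-parity : ∀ s t → All (λ κ → ∃ λ I → κ + (I + I) ≡ s) (cuts s t)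
cuts-parity 0 t = All.map (λ { refl → 0 , refl }) (cuts-0≡0 t)
cuts-parity 1 t = All-copies t (All.map⁺ (All.map (λ (I , eq) → I , cong suc eq) (cuts-parity 0 (pred t))))
cuts-parity (suc (suc s)) t = All.++⁺
  (All-copies (suc s) (All.map (λ {κ} (I , eq) → suc I , trans (lemma κ I) (cong (2 +_) eq)) (cuts-parity s t)))
  (All-copies t (All.map⁺ (All.map (λ (I , eq) → I , cong suc eq) (cuts-parity (suc s) (pred t)))))
  where
  lemma : ∀ κ I → κ + (suc I + suc I) ≡ 2 + (κ + (I + I))
  lemma = solve-∀

-- The shift makes this s(s - 1)/2, the number of pairs in `S`; divided by n - 1 it is the mean
-- number of edges inside `S`.
triangle : ℕ → ℕ
triangle zero    = 0
triangle (suc s) = s + triangle s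

triangle-double : ∀ s → triangle (suc s) + triangle (suc s) ≡ s * suc s
triangle-double zero    = refl
triangle-double (suc s) = begin-equality
  suc s + triangle (suc s) + (suc s + triangle (suc s)) ≡⟨ lemma₁ s (triangle (suc s)) ⟩
  2 * suc s + (triangle (suc s) + triangle (suc s))     ≡⟨ cong (2 * suc s +_) (triangle-double s) ⟩
  2 * suc s + s * suc s                                 ≡⟨ lemma₂ s ⟩
  suc s * suc (suc s)                                   ∎
  where
  lemma₁ : ∀ s x → suc s + x + (suc s + x) ≡ 2 * suc s + (x + x)
  lemma₁ = solve-∀
  lemma₂ : ∀ s → 2 * suc s + s * suc s ≡ suc s * suc (suc s)
  lemma₂ = solve-∀

-- If κ of the s vertices of S have partners outside S, then (s − κ)/2 edges lie
-- inside S, and the weight is bˢ (c/b)^((s − κ)/2).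
weight : ℕ → ℕ → ℕ → ℕ → ℕ
weight b c s κ = b ^ κ * (b * c) ^ ⌊ s ∸ κ /2⌋

weight-parity : ∀ b c {s} κ I → κ + (I + I) ≡ s → weight b c s κ ≡ b ^ κ * (b * c) ^ I
weight-parity b c κ I refl = cong (λ x → b ^ κ * (b * c) ^ x)
  (trans (cong ⌊_/2⌋ (m+n∸m≡n κ (I + I))) (sym (n≡⌊n+n/2⌋ I)))

module _ (b c : ℕ) where

  totalWeight : ℕ → ℕ → ℕ
  totalWeight s t = sum (map (weight b c s) (cuts s t))

  totalWeight-0 : ∀ t → totalWeight 0 t ≡ matchings# t
  totalWeight-0 t = trans (go (cuts-0≡0 t)) (length-cuts 0 t)
    where
    go : ∀ {xs} → All (_≡ 0) xs → sum (map (weight b c 0) xs) ≡ length xs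
    go []         = refl
    go (refl ∷ p) = cong suc (go p)

  weight-cross : ∀ s xs → sum (map (weight b c (suc s)) (map suc xs)) ≡ b * sum (map (weight b c s) xs)
  weight-cross s xs = begin-equality
    sum (map (weight b c (suc s)) (map suc xs))     ≡⟨ cong sum (sym (map-∘ xs)) ⟩
    sum (map (weight b c (suc s) ∘ suc) xs)         ≡⟨ cong sum (map-cong (λ κ → *-assoc b (b ^ κ) _) xs) ⟩
    sum (map (λ κ → b * weight b c s κ) xs)         ≡⟨ sum-map-*ˡ b (weight b c s) xs ⟩
    b * sum (map (weight b c s) xs)                 ∎

  weight-internal : ∀ s κ I → κ + (I + I) ≡ s → weight b c (2 + s) κ ≡ b * c * weight b c s κ
  weight-internal s κ I eq = begin-equality
    weight b c (2 + s) κ               ≡⟨ weight-parity b c κ (suc I) (trans (lemma₁ κ I) (cong (2 +_) eq)) ⟩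
    b ^ κ * (b * c * (b * c) ^ I)      ≡⟨ lemma₂ (b ^ κ) (b * c) ((b * c) ^ I) ⟩
    b * c * (b ^ κ * (b * c) ^ I)      ≡⟨ cong (b * c *_) (weight-parity b c κ I eq) ⟨
    b * c * weight b c s κ             ∎
    where
    lemma₁ : ∀ κ I → κ + (suc I + suc I) ≡ 2 + (κ + (I + I))
    lemma₁ = solve-∀
    lemma₂ : ∀ x y z → x * (y * z) ≡ y * (x * z)
    lemma₂ = solve-∀

  totalWeight-1 : ∀ t → totalWeight 1 t ≡ b * matchings# (1 + t)
  totalWeight-1 t = begin-equality
    totalWeight 1 t                                              ≡⟨ sum-map-copies (weight b c 1) t _ ⟩
    t * sum (map (weight b c 1) (map suc (cuts 0 (pred t))))     ≡⟨ cong (t *_) (weight-cross 0 (cuts 0 (pred t))) ⟩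
    t * (b * totalWeight 0 (pred t))                             ≡⟨ cong (λ x → t * (b * x)) (totalWeight-0 (pred t)) ⟩
    t * (b * matchings# (pred t))                                ≡⟨ lemma t b (matchings# (pred t)) ⟩
    b * (t * matchings# (pred t))                                ≡⟨ cong (b *_) (matchings#-suc t) ⟨
    b * matchings# (1 + t)                                       ∎
    where
    lemma : ∀ x y z → x * (y * z) ≡ y * (x * z)
    lemma = solve-∀

  -- An exposed internal edge uses two vertices of `S` and contributes b² (c/b) = bc; a crossing
  -- edge uses one and contributes b.
  totalWeight-2+ : ∀ s t → totalWeight (2 + s) t ≡
    suc s * (b * c * totalWeight s t) + t * (b * totalWeight (1 + s) (pred t))
  totalWeight-2+ s t = begin-equality
    totalWeight (2 + s) t
      ≡⟨ sum-map-++ w (copies (suc s) (cuts s t)) _ ⟩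
    sum (map w (copies (suc s) (cuts s t))) + sum (map w (copies t (map suc (cuts (suc s) (pred t)))))
      ≡⟨ cong₂ _+_ (sum-map-copies w (suc s) (cuts s t)) (sum-map-copies w t _) ⟩
    suc s * sum (map w (cuts s t)) + t * sum (map w (map suc (cuts (suc s) (pred t))))
      ≡⟨ cong₂ (λ x y → suc s * x + t * y) internal (weight-cross (suc s) (cuts (suc s) (pred t))) ⟩
    suc s * (b * c * totalWeight s t) + t * (b * totalWeight (1 + s) (pred t)) ∎
    where
    w = weight b c (2 + s)
    internal : sum (map w (cuts s t)) ≡ b * c * totalWeight s t
    internal = trans
      (cong sum (map-cong-local (All.map (λ {κ} (I , eq) → weight-internal s κ I eq) (cuts-parity s t))))
      (sum-map-*ˡ (b * c) (weight b c s) (cuts s t))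

-- The two inductive bounds, for an internal and for a crossing first edge, share the factor `p₀`
-- over `q₀`. Once it is taken out, the conclusion of `exposure-step` is exactly what is needed.
exposure-sum : ∀ b c u v W₀ W₁ B M p₀ q₀ eP eQ gP gQ →
  W₀ * q₀ ≤ B * M * p₀ → W₁ * (eQ * q₀) ≤ b * B * M * (eP * p₀) →
  (1 + u) * c * eQ * gQ + (1 + v) * b * eP * gQ ≤ (2 + (u + v)) * b * eP * gP →
  (suc u * (b * c * W₀) + suc v * (b * W₁)) * (eQ * q₀ * gQ) ≤
  b * (b * B) * ((2 + (u + v)) * M) * (eP * p₀ * gP)
exposure-sum b c u v W₀ W₁ B M p₀ q₀ eP eQ gP gQ h₀ h₁ h = begin
  (suc u * (b * c * W₀) + suc v * (b * W₁)) * (eQ * q₀ * gQ)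
    ≡⟨ lemma₁ u v b c W₀ W₁ q₀ eQ gQ ⟩
  suc u * (b * c) * gQ * eQ * (W₀ * q₀) + suc v * b * gQ * (W₁ * (eQ * q₀))
    ≤⟨ +-mono-≤ (*-monoʳ-≤ (suc u * (b * c) * gQ * eQ) h₀) (*-monoʳ-≤ (suc v * b * gQ) h₁) ⟩
  suc u * (b * c) * gQ * eQ * (B * M * p₀) + suc v * b * gQ * (b * B * M * (eP * p₀))
    ≡⟨ lemma₂ u v b c M gQ eQ eP B p₀ ⟩
  b * B * M * p₀ * ((1 + u) * c * eQ * gQ + (1 + v) * b * eP * gQ)
    ≤⟨ *-monoʳ-≤ (b * B * M * p₀) h ⟩
  b * B * M * p₀ * ((2 + (u + v)) * b * eP * gP)
    ≡⟨ lemma₃ b B M p₀ (2 + (u + v)) eP gP ⟩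
  b * (b * B) * ((2 + (u + v)) * M) * (eP * p₀ * gP) ∎
  where
  lemma₁ : ∀ u v b c W₀ W₁ x e g → (suc u * (b * c * W₀) + suc v * (b * W₁)) * (e * x * g) ≡
    suc u * (b * c) * g * e * (W₀ * x) + suc v * b * g * (W₁ * (e * x))
  lemma₁ = solve-∀
  lemma₂ : ∀ u v b c M gQ eQ eP B X →
    suc u * (b * c) * gQ * eQ * (B * M * X) + suc v * b * gQ * (b * B * M * (eP * X)) ≡
    b * B * M * X * ((1 + u) * c * eQ * gQ + (1 + v) * b * eP * gQ)
  lemma₂ = solve-∀
  lemma₃ : ∀ b B M X n eP gP → b * B * M * X * (n * b * eP * gP) ≡ b * (b * B) * (n * M) * (eP * X * gP)
  lemma₃ = solve-∀

module _ (b c N p q K : ℕ) (R : ℕ → ℕ) .{{b≢0 : NonZero b}}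
         (q≡bN : q ≡ b * N) (p+b≡q+c : p + b ≡ q + c)
         (jR≡N : ∀ j → 1 ≤ j → j ≤ K → j * R j ≡ N) (N≢0 : NonZero N) where

  private
    -- As `R m` is N/m for 1 ≤ m ≤ K, E s m / N is then the mean number of edges inside a set of `s`
    -- among `m + 1` vertices, and (p/q)^(E s m) takes the place of exp(y E[I]).
    E : ℕ → ℕ → ℕ
    E s m = triangle s * R m

    R≢0 : ∀ j → 1 ≤ j → j ≤ K → NonZero (R j)
    R≢0 j 1≤j j≤K = m*n≢0⇒n≢0 j {{subst NonZero (sym (jR≡N j 1≤j j≤K)) N≢0}}

    -- The law of total expectation. Let M₀ and M₁ = M₀ + q be the means left after an internal and
    -- a crossing edge, with probabilities p and 1 - p as in `exposure-step`. Then the mean is p (1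
    -- + M₀) + (1 - p) M₁ = M₁ + p (1 - q), and `δ` is N p (1 - q).
    E-step : ∀ u v → 1 ≤ u + v → 2 + (u + v) ≤ K →
      ∃ λ δ → E (2 + u) (2 + (u + v)) ≡ E (1 + u) (u + v) + δ ×
              (u + v) * δ ≡ (1 + u) * v * R (2 + (u + v))
    E-step u v 1≤m m+2≤K with m ← u + v in m≡ = δ , sym (proj₂ split) , mδ
      where
      τ = triangle (1 + u)
      r = R (2 + m)
      m≢0 = >-nonZero 1≤m
      key : m * ((1 + u + τ) * r) ≡ m * (τ * R m) + (1 + u) * v * r
      key = begin-equality
        m * ((1 + u + τ) * r)                          ≡⟨ lemma₁ m u τ r ⟩
        m * (1 + u) * r + τ * (m * r)                  ≡⟨ cong (λ x → x * (1 + u) * r + τ * (m * r)) (sym m≡) ⟩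
        (u + v) * (1 + u) * r + τ * (m * r)            ≡⟨ lemma₂ u v τ (m * r) r ⟩
        u * (1 + u) * r + τ * (m * r) + (1 + u) * v * r ≡⟨ cong (λ x → x * r + τ * (m * r) + (1 + u) * v * r) (sym (triangle-double u)) ⟩
        (τ + τ) * r + τ * (m * r) + (1 + u) * v * r    ≡⟨ lemma₃ u v m τ r ⟩
        τ * ((2 + m) * r) + (1 + u) * v * r            ≡⟨ cong (λ x → τ * x + (1 + u) * v * r) (trans (jR≡N (2 + m) (s≤s z≤n) m+2≤K) (sym (jR≡N m 1≤m (≤-trans (m≤n+m m 2) m+2≤K)))) ⟩
        τ * (m * R m) + (1 + u) * v * r                ≡⟨ cong (_+ (1 + u) * v * r) (lemma₄ τ m (R m)) ⟩
        m * (τ * R m) + (1 + u) * v * r                ∎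
        where
        lemma₁ : ∀ m u τ r → m * ((1 + u + τ) * r) ≡ m * (1 + u) * r + τ * (m * r)
        lemma₁ = solve-∀
        lemma₂ : ∀ u v τ x r → (u + v) * (1 + u) * r + τ * x ≡ u * (1 + u) * r + τ * x + (1 + u) * v * r
        lemma₂ = solve-∀
        lemma₃ : ∀ u v m τ r → (τ + τ) * r + τ * (m * r) + (1 + u) * v * r ≡ τ * ((2 + m) * r) + (1 + u) * v * r
        lemma₃ = solve-∀
        lemma₄ : ∀ τ m r → τ * (m * r) ≡ m * (τ * r)
        lemma₄ = solve-∀
      split : ∃ λ δ → τ * R m + δ ≡ (1 + u + τ) * r
      split = m≤n⇒∃[o]m+o≡n (*-cancelˡ-≤ m {{m≢0}} (begin
        m * (τ * R m)                     ≤⟨ m≤m+n _ _ ⟩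
        m * (τ * R m) + (1 + u) * v * r   ≡⟨ key ⟨
        m * ((1 + u + τ) * r)             ∎))
      δ = proj₁ split
      mδ : m * δ ≡ (1 + u) * v * r
      mδ = +-cancelˡ-≡ (m * (τ * R m)) _ _ (begin-equality
        m * (τ * R m) + m * δ             ≡⟨ *-distribˡ-+ m (τ * R m) δ ⟨
        m * (τ * R m + δ)                 ≡⟨ cong (m *_) (proj₂ split) ⟩
        m * ((1 + u + τ) * r)             ≡⟨ key ⟩
        m * (τ * R m) + (1 + u) * v * r   ∎)

    -- This is `surrogate-≥` at the exponent N u/(u + v), the difference of `E` between `u` and
    -- `1 + u` vertices of `S`. With `growth₂`, its counterpart at `δ`, it supplies the hypotheses
    -- of `exposure-step`.
    growth₁ : ∀ u v → 1 ≤ u + v → u + v ≤ K →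
      q ^ (u * R (u + v)) * (v * b + u * c) ≤ (u + v) * b * p ^ (u * R (u + v))
    growth₁ u v 1≤m m≤K = *-cancelˡ-≤ r {{R≢0 (u + v) 1≤m m≤K}} (core (p ^ (u * r)) (q ^ (u * r)) (surrogate-≥ b c N p q q≡bN p+b≡q+c (u * r)))
      where
      r = R (u + v)
      q≡ : q ≡ b * ((u + v) * r)
      q≡ = trans q≡bN (cong (b *_) (sym (jR≡N (u + v) 1≤m m≤K)))
      lemma₁ : ∀ X b c u v r → r * (X * (v * b + u * c)) + u * r * b * X ≡ X * (b * ((u + v) * r) + u * r * c)
      lemma₁ = solve-∀
      lemma₂ : ∀ X Y b u v r → Y * (b * ((u + v) * r)) + u * r * b * X ≡ r * ((u + v) * b * Y) + u * r * b * X
      lemma₂ = solve-∀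
      core : ∀ Y X → X * (q + u * r * c) ≤ Y * q + u * r * b * X →
             r * (X * (v * b + u * c)) ≤ r * ((u + v) * b * Y)
      core Y X h = +-cancelʳ-≤ (u * r * b * X) _ _ (begin
        r * (X * (v * b + u * c)) + u * r * b * X      ≡⟨ lemma₁ X b c u v r ⟩
        X * (b * ((u + v) * r) + u * r * c)            ≡⟨ cong (λ x → X * (x + u * r * c)) q≡ ⟨
        X * (q + u * r * c)                            ≤⟨ h ⟩
        Y * q + u * r * b * X                          ≡⟨ cong (λ x → Y * x + u * r * b * X) q≡ ⟩
        Y * (b * ((u + v) * r)) + u * r * b * X        ≡⟨ lemma₂ X Y b u v r ⟩
        r * ((u + v) * b * Y) + u * r * b * X          ∎)

    growth₂ : ∀ u v δ → 2 + (u + v) ≤ K → (u + v) * δ ≡ (1 + u) * v * R (2 + (u + v)) →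
      q ^ δ * ((1 + v) * (u + v) * b + (1 + u) * (u * b + v * c)) ≤ (2 + (u + v)) * (u + v) * b * p ^ δ
    growth₂ u v δ m+2≤K mδ = *-cancelˡ-≤ r {{R≢0 _ (s≤s z≤n) m+2≤K}} (core (p ^ δ) (q ^ δ) (surrogate-≥ b c N p q q≡bN p+b≡q+c δ))
      where
      r = R (2 + (u + v))
      q≡ : q ≡ b * ((2 + (u + v)) * r)
      q≡ = trans q≡bN (cong (b *_) (sym (jR≡N _ (s≤s z≤n) m+2≤K)))
      lemma₁ : ∀ X b c u v r →
        r * (X * ((1 + v) * (u + v) * b + (1 + u) * (u * b + v * c))) + (1 + u) * v * r * (b * X) ≡
        X * ((u + v) * (b * ((2 + (u + v)) * r)) + (1 + u) * v * r * c)
      lemma₁ = solve-∀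
      lemma₂ : ∀ X m q δ c → X * (m * q + m * δ * c) ≡ m * (X * (q + δ * c))
      lemma₂ = solve-∀
      lemma₃ : ∀ Y X m q δ b → m * (Y * q + δ * b * X) ≡ m * (Y * q) + m * δ * (b * X)
      lemma₃ = solve-∀
      lemma₄ : ∀ Y b m r → m * (Y * (b * ((2 + m) * r))) ≡ r * ((2 + m) * m * b * Y)
      lemma₄ = solve-∀
      core : ∀ Y X → X * (q + δ * c) ≤ Y * q + δ * b * X →
             r * (X * ((1 + v) * (u + v) * b + (1 + u) * (u * b + v * c))) ≤ r * ((2 + (u + v)) * (u + v) * b * Y)
      core Y X h = +-cancelʳ-≤ ((1 + u) * v * r * (b * X)) _ _ (begin
        r * (X * ((1 + v) * (u + v) * b + (1 + u) * (u * b + v * c))) + (1 + u) * v * r * (b * X)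
          ≡⟨ lemma₁ X b c u v r ⟩
        X * ((u + v) * (b * ((2 + (u + v)) * r)) + (1 + u) * v * r * c)
          ≡⟨ cong₂ (λ x y → X * ((u + v) * x + y * c)) q≡ mδ ⟨
        X * ((u + v) * q + (u + v) * δ * c)
          ≡⟨ lemma₂ X (u + v) q δ c ⟩
        (u + v) * (X * (q + δ * c))
          ≤⟨ *-monoʳ-≤ (u + v) h ⟩
        (u + v) * (Y * q + δ * b * X)
          ≡⟨ lemma₃ Y X (u + v) q δ b ⟩
        (u + v) * (Y * q) + (u + v) * δ * (b * X)
          ≡⟨ cong₂ (λ x y → (u + v) * (Y * x) + y * (b * X)) q≡ mδ ⟩
        (u + v) * (Y * (b * ((2 + (u + v)) * r))) + (1 + u) * v * r * (b * X)
          ≡⟨ cong (_+ (1 + u) * v * r * (b * X)) (lemma₄ Y b (u + v) r) ⟩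
        r * ((2 + (u + v)) * (u + v) * b * Y) + (1 + u) * v * r * (b * X) ∎)

  private
    Bound : ℕ → ℕ → ℕ → Set
    Bound s t n = totalWeight b c s t * q ^ E s (pred n) ≤ b ^ s * matchings# n * p ^ E s (pred n)

    bound-step : ∀ u v → 1 ≤ u + v → 2 + (u + v) ≤ K →
      Bound u (suc v) (suc (u + v)) → Bound (suc u) v (suc (u + v)) →
      Bound (2 + u) (suc v) (3 + (u + v))
    bound-step u v 1≤m m+2≤K ih₀ ih₁ = subst₂ _≤_
      (cong₂ _*_ (sym (totalWeight-2+ b c u (suc v))) (sym (E₂ q)))
      (cong (b ^ (2 + u) * ((2 + (u + v)) * matchings# (suc (u + v))) *_) (sym (E₂ p)))
      (exposure-sum b c u v (totalWeight b c u (suc v)) (totalWeight b c (suc u) v) (b ^ u) (matchings# (suc (u + v)))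
        (p ^ E u (u + v)) (q ^ E u (u + v)) (p ^ (u * R (u + v))) (q ^ (u * R (u + v))) (p ^ δ) (q ^ δ)
        ih₀
        (subst₂ (λ x y → totalWeight b c (suc u) v * x ≤ b ^ suc u * matchings# (suc (u + v)) * y) (E₁ q) (E₁ p) ih₁)
        (exposure-step b c u v (p ^ (u * R (u + v))) (q ^ (u * R (u + v))) (p ^ δ) (q ^ δ) {{b≢0}} {{>-nonZero 1≤m}}
          (growth₁ u v 1≤m (≤-trans (m≤n+m (u + v) 2) m+2≤K)) (growth₂ u v δ m+2≤K (proj₂ (proj₂ step)))))
      where
      step = E-step u v 1≤m m+2≤K
      δ = proj₁ step
      E₁ : ∀ x → x ^ E (1 + u) (u + v) ≡ x ^ (u * R (u + v)) * x ^ E u (u + v)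
      E₁ x = trans (cong (x ^_) (*-distribʳ-+ (R (u + v)) u (triangle u))) (^-distribˡ-+-* x (u * R (u + v)) (E u (u + v)))
      E₂ : ∀ x → x ^ E (2 + u) (2 + (u + v)) ≡ x ^ (u * R (u + v)) * x ^ E u (u + v) * x ^ δ
      E₂ x = trans (cong (x ^_) (proj₁ (proj₂ step)))
        (trans (^-distribˡ-+-* x (E (1 + u) (u + v)) δ) (cong (_* x ^ δ) (E₁ x)))

  -- The condition `s ≤ t` is inherited by both smaller instances and forces `u + v ≥ 1`, the number
  -- by which their means are divided. For `s` at most 1 no internal edge is possible and equality
  -- holds.
  mgf : ∀ s t → s ≤ t → s + t ≤ suc K → Bound s t (s + t)
  mgf 0 t _ _ = ≤-reflexive (trans (cong (_* 1) (totalWeight-0 b c t)) (lemma (matchings# t)))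
    where
    lemma : ∀ m → m * 1 ≡ 1 * m * 1
    lemma = solve-∀
  mgf 1 t _ _ = ≤-reflexive (trans (cong (_* 1) (totalWeight-1 b c t)) (cong (λ x → x * matchings# (1 + t) * 1) (sym (*-identityʳ b))))
  mgf (suc (suc u)) (suc v) (s≤s 1+u≤v) s+t≤1+K =
    subst (λ n → Bound (2 + u) (suc v) (2 + n)) (sym (+-suc u v))
      (bound-step u v (≤-trans (s≤s z≤n) (≤-trans 1+u≤v (m≤n+m v u))) m+2≤K
        (subst (Bound u (suc v)) (+-suc u v)
          (mgf u (suc v) (m≤n⇒m≤1+n (≤-trans (n≤1+n u) 1+u≤v)) (≤-trans (m≤n+m (u + suc v) 2) s+t≤1+K)))
        (mgf (suc u) v 1+u≤v (≤-trans (n≤1+n (1 + (u + v))) (≤-trans m+2≤K (n≤1+n K)))))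
    where
    m+2≤K : 2 + (u + v) ≤ K
    m+2≤K = subst (_≤ K) (cong suc (+-suc u v)) (≤-pred s+t≤1+K)

-- This eliminates the surrogate base: (V/U)^X ≤ (p/q)^(eX) = ((p/q)^j)^z ≤ (c/b)^z.
*-^-exchange : ∀ {V q e U p b c} X j z → .{{_ : NonZero q}} →
  V * q ^ e ≤ U * p ^ e → b * p ^ j ≤ c * q ^ j → e * X ≡ j * z →
  V ^ X * b ^ z ≤ U ^ X * c ^ z
*-^-exchange {V} {q} {e} {U} {p} {b} {c} X j z h₁ h₂ eX≡jz =
  *-cancelʳ-≤ _ _ (q ^ (e * X)) {{m^n≢0 q (e * X)}} (begin
    V ^ X * b ^ z * q ^ (e * X)     ≡⟨ lemma (V ^ X) (b ^ z) (q ^ (e * X)) ⟩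
    V ^ X * q ^ (e * X) * b ^ z     ≡⟨ cong (_* b ^ z) (fold V q) ⟩
    (V * q ^ e) ^ X * b ^ z         ≤⟨ *-monoˡ-≤ (b ^ z) (^-monoˡ-≤ X h₁) ⟩
    (U * p ^ e) ^ X * b ^ z         ≡⟨ cong (_* b ^ z) (sym (fold U p)) ⟩
    U ^ X * p ^ (e * X) * b ^ z     ≡⟨ cong (λ x → U ^ X * p ^ x * b ^ z) eX≡jz ⟩
    U ^ X * p ^ (j * z) * b ^ z     ≡⟨ lemma′ (U ^ X) (p ^ (j * z)) (b ^ z) ⟩
    U ^ X * (b ^ z * p ^ (j * z))   ≡⟨ cong (U ^ X *_) (fold′ b p) ⟩
    U ^ X * (b * p ^ j) ^ z         ≤⟨ *-monoʳ-≤ (U ^ X) (^-monoˡ-≤ z h₂) ⟩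
    U ^ X * (c * q ^ j) ^ z         ≡⟨ cong (U ^ X *_) (sym (fold′ c q)) ⟩
    U ^ X * (c ^ z * q ^ (j * z))   ≡⟨ cong (λ x → U ^ X * (c ^ z * q ^ x)) (sym eX≡jz) ⟩
    U ^ X * (c ^ z * q ^ (e * X))   ≡⟨ *-assoc (U ^ X) (c ^ z) _ ⟨
    U ^ X * c ^ z * q ^ (e * X)     ∎)
  where
  fold : ∀ V q → V ^ X * q ^ (e * X) ≡ (V * q ^ e) ^ X
  fold V q = trans (cong (V ^ X *_) (sym (^-*-assoc q e X))) (sym (^-distribʳ-* V (q ^ e) X))
  fold′ : ∀ V q → V ^ z * q ^ (j * z) ≡ (V * q ^ j) ^ z
  fold′ V q = trans (cong (V ^ z *_) (sym (^-*-assoc q j z))) (sym (^-distribʳ-* V (q ^ j) z))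
  lemma : ∀ x y z → x * y * z ≡ x * z * y
  lemma = solve-∀
  lemma′ : ∀ x y z → x * y * z ≡ x * (z * y)
  lemma′ = solve-∀

-- With I the number of edges inside S and μ = s (s − 1) / 2K its mean, this says
-- E[(c/b)ᴵ] ≤ (c/b)^((c/b) μ).
mgf-bound : ∀ b c s t K → .{{_ : NonZero b}} → .{{c≢0 : NonZero c}} → .{{_ : NonZero K}} →
  s ≤ t → s + t ≡ suc K →
  totalWeight b c s t ^ (b * K) * b ^ (c * triangle s) ≤
  (b ^ s * matchings# (suc K)) ^ (b * K) * c ^ (c * triangle s)
mgf-bound b c s t K {{_}} {{c≢0}} s≤t n≡ =
  *-^-exchange {e = triangle s * R K} (b * K) (b * K !) (c * triangle s) {{m*n≢0 b N}}
    (subst (λ n → totalWeight b c s t * (b * N) ^ (triangle s * R (pred n)) ≤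
                  b ^ s * matchings# n * p ^ (triangle s * R (pred n))) n≡
      (mgf b c N p (b * N) K R refl p+b jR≡N N≢0 s t s≤t (≤-reflexive n≡)))
    (surrogate-≤ b c N p (b * N) refl p+b (K !) refl {{p≢0}})
    exps
  where
  -- `K !` makes N/j a natural number for every j from 1 to K, and the factor `c` gives N the shape
  -- `c * L` that `surrogate-≤` asks for.
  N = c * K !
  instance
    N≢0 : NonZero N
    N≢0 = m*n≢0 c (K !) {{c≢0}} {{K !≢0}}
  -- This is bN + c - b, with one `b` taken out of the product so that no truncated subtraction
  -- arises.
  p = b * pred N + c
  p≢0 : NonZero p
  p≢0 = >-nonZero (≤-trans (>-nonZero⁻¹ c) (m≤n+m c (b * pred N)))
  R : ℕ → ℕ
  R zero    = 0
  R (suc j) = c * (K ! / suc j)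
  lemma : ∀ b c n → b * n + c + b ≡ b * suc n + c
  lemma = solve-∀
  p+b : p + b ≡ b * N + c
  p+b = trans (lemma b c (pred N)) (cong (λ x → b * x + c) (suc-pred N))
  lemma₁ : ∀ x y z → x * (y * z) ≡ y * (x * z)
  lemma₁ = solve-∀
  jR≡N : ∀ j → 1 ≤ j → j ≤ K → j * R j ≡ N
  jR≡N (suc j) _ j<K = trans (lemma₁ (suc j) c (K ! / suc j))
    (cong (c *_) (m*[n/m]≡n (∣-trans (m∣m*n (j !)) (m≤n⇒m!∣n! j<K))))
  lemma₂ : ∀ τ r b K → τ * r * (b * K) ≡ τ * b * (K * r)
  lemma₂ = solve-∀
  lemma₃ : ∀ τ b c f → τ * b * (c * f) ≡ b * f * (c * τ)
  lemma₃ = solve-∀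
  exps : triangle s * R K * (b * K) ≡ b * K ! * (c * triangle s)
  exps = begin-equality
    triangle s * R K * (b * K)       ≡⟨ lemma₂ (triangle s) (R K) b K ⟩
    triangle s * b * (K * R K)       ≡⟨ cong (triangle s * b *_) (jR≡N K (>-nonZero⁻¹ K) ≤-refl) ⟩
    triangle s * b * (c * K !)       ≡⟨ lemma₃ (triangle s) b c (K !) ⟩
    b * K ! * (c * triangle s)       ∎

-- Binomial coefficients and the numerical constants

-- Here 4 stands in for e: 1 + 1/k ≤ (1 + 1/2k)², and (1 + 1/2k)^k ≤ 2 is `surrogate-≤` with b = 1,
-- c = 2 and L = k.
[1+k]^k≤4k^k : ∀ k → suc k ^ k ≤ 4 * k ^ k
[1+k]^k≤4k^k zero      = s≤s z≤n
[1+k]^k≤4k^k k@(suc _) = *-cancelʳ-≤ _ _ ((4 * k) ^ k) {{m^n≢0 (4 * k) k}} (begin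
  suc k ^ k * (4 * k) ^ k                   ≡⟨ ^-distribʳ-* (suc k) (4 * k) k ⟨
  (suc k * (4 * k)) ^ k                     ≤⟨ ^-monoˡ-≤ k (≤-trans (n≤1+n _) (≤-reflexive (lemma₁ k))) ⟩
  (suc (2 * k) * suc (2 * k)) ^ k           ≡⟨ ^-distribʳ-* (suc (2 * k)) (suc (2 * k)) k ⟩
  suc (2 * k) ^ k * suc (2 * k) ^ k         ≤⟨ *-mono-≤ half half ⟩
  2 * (2 * k) ^ k * (2 * (2 * k) ^ k)       ≡⟨ lemma₂ ((2 * k) ^ k) ⟩
  4 * ((2 * k) ^ k * (2 * k) ^ k)           ≡⟨ cong (4 *_) (^-distribʳ-* (2 * k) (2 * k) k) ⟨
  4 * (2 * k * (2 * k)) ^ k                 ≡⟨ cong (λ x → 4 * x ^ k) (lemma₃ k) ⟩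
  4 * (k * (4 * k)) ^ k                     ≡⟨ cong (4 *_) (^-distribʳ-* k (4 * k) k) ⟩
  4 * (k ^ k * (4 * k) ^ k)                 ≡⟨ *-assoc 4 (k ^ k) _ ⟨
  4 * k ^ k * (4 * k) ^ k                   ∎)
  where
  lemma₁ : ∀ k → suc (suc k * (4 * k)) ≡ suc (2 * k) * suc (2 * k)
  lemma₁ = solve-∀
  lemma₂ : ∀ x → 2 * x * (2 * x) ≡ 4 * (x * x)
  lemma₂ = solve-∀
  lemma₃ : ∀ k → 2 * k * (2 * k) ≡ k * (4 * k)
  lemma₃ = solve-∀
  lemma₄ : ∀ k → suc (2 * k) + 1 ≡ 2 * k + 2
  lemma₄ = solve-∀
  half : suc (2 * k) ^ k ≤ 2 * (2 * k) ^ k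
  half = begin
    suc (2 * k) ^ k                ≡⟨ *-identityˡ _ ⟨
    1 * suc (2 * k) ^ k            ≡⟨ cong (λ x → 1 * suc (2 * k) ^ x) (*-identityˡ k) ⟨
    1 * suc (2 * k) ^ (1 * k)      ≤⟨ surrogate-≤ 1 2 (2 * k) (suc (2 * k)) (2 * k) (sym (*-identityˡ (2 * k))) (lemma₄ k) k refl ⟩
    2 * (2 * k) ^ (1 * k)          ≡⟨ cong (λ x → 2 * (2 * k) ^ x) (*-identityˡ k) ⟩
    2 * (2 * k) ^ k                ∎

k^k≤4^k*k! : ∀ k → k ^ k ≤ 4 ^ k * k !
k^k≤4^k*k! zero    = ≤-refl
k^k≤4^k*k! (suc k) = begin
  suc k * suc k ^ k            ≤⟨ *-monoʳ-≤ (suc k) ([1+k]^k≤4k^k k) ⟩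
  suc k * (4 * k ^ k)          ≤⟨ *-monoʳ-≤ (suc k) (*-monoʳ-≤ 4 (k^k≤4^k*k! k)) ⟩
  suc k * (4 * (4 ^ k * k !))  ≡⟨ lemma (suc k) (4 ^ k) (k !) ⟩
  4 * 4 ^ k * (suc k * k !)    ∎
  where
  lemma : ∀ k x y → k * (4 * (x * y)) ≡ 4 * x * (k * y)
  lemma = solve-∀

-- Induction by Pascal's rule; the step uses only the two leading terms of (n + 1)^(k + 1).
nCk*k!≤n^k : ∀ n k → (n C k) * k ! ≤ n ^ k
nCk*k!≤n^k n       zero    = ≤-reflexive (trans (*-identityʳ (n C 0)) (trans (nCk≡nC[n∸k] {k = 0} {n = n} z≤n) (nCn≡1 n)))
nCk*k!≤n^k zero    (suc k) = ≤-trans (≤-reflexive (cong (_* suc k !) (k>n⇒nCk≡0 {0} {suc k} (s≤s z≤n)))) z≤n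
nCk*k!≤n^k (suc n) (suc k) = begin
  (suc n C suc k) * suc k !                             ≡⟨ cong (_* suc k !) (nCk+nC[k+1]≡[n+1]C[k+1] n k) ⟨
  (n C k + n C suc k) * suc k !                         ≡⟨ lemma (n C k) (n C suc k) (suc k) (k !) ⟩
  suc k * ((n C k) * k !) + (n C suc k) * suc k !       ≤⟨ +-mono-≤ (*-monoʳ-≤ (suc k) (nCk*k!≤n^k n k)) (nCk*k!≤n^k n (suc k)) ⟩
  suc k * n ^ k + n ^ suc k                             ≤⟨ binomial n k ⟩
  suc n ^ suc k                                         ∎
  where
  lemma : ∀ x y k f → (x + y) * (k * f) ≡ k * (x * f) + y * (k * f)
  lemma = solve-∀
  lemma₂ : ∀ n k x → (2 + k) * (n * x) + n * (n * x) + suc k * x ≡ suc n * (suc k * x + n * x)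
  lemma₂ = solve-∀
  binomial : ∀ n k → suc k * n ^ k + n ^ suc k ≤ suc n ^ suc k
  binomial n zero    = ≤-reflexive (lemma₃ n)
    where
    lemma₃ : ∀ n → 1 * 1 + n * 1 ≡ suc n * 1
    lemma₃ = solve-∀
  binomial n (suc k) = begin
    (2 + k) * n ^ suc k + n ^ suc (suc k)                   ≤⟨ m≤m+n _ (suc k * n ^ k) ⟩
    (2 + k) * n ^ suc k + n ^ suc (suc k) + suc k * n ^ k   ≡⟨ lemma₂ n k (n ^ k) ⟩
    suc n * (suc k * n ^ k + n ^ suc k)                     ≤⟨ *-monoʳ-≤ (suc n) (binomial n k) ⟩
    suc n ^ suc (suc k)                                     ∎

nCk*k^k≤[4n]^k : ∀ n k → (n C k) * k ^ k ≤ (4 * n) ^ k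
nCk*k^k≤[4n]^k n k = begin
  (n C k) * k ^ k            ≤⟨ *-monoʳ-≤ (n C k) (k^k≤4^k*k! k) ⟩
  (n C k) * (4 ^ k * k !)    ≡⟨ lemma (n C k) (4 ^ k) (k !) ⟩
  4 ^ k * ((n C k) * k !)    ≤⟨ *-monoʳ-≤ (4 ^ k) (nCk*k!≤n^k n k) ⟩
  4 ^ k * n ^ k              ≡⟨ ^-distribʳ-* 4 n k ⟨
  (4 * n) ^ k                ∎
  where
  lemma : ∀ x y z → x * (y * z) ≡ y * (x * z)
  lemma = solve-∀

-- (1 + x/120)ⁱ ≥ 4x for x = n/k ≥ 100; i = 10 meets the numerical condition.
4n*[120k]^i≤k*[120k+n]^i : ∀ i → 10 ≤ i → 400 * 120 ^ i ≤ 220 ^ i →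
  ∀ n k → 100 * k ≤ n → 4 * n * (120 * k) ^ i ≤ k * (120 * k + n) ^ i
4n*[120k]^i≤k*[120k+n]^i i 10≤i h n k 100k≤n with (e , refl) ← m≤n⇒∃[o]m+o≡n 100k≤n = *-cancelˡ-≤ 220 (begin
  220 * (4 * (100 * k + e) * (120 * k) ^ i)           ≡⟨ cong (λ x → 220 * (4 * (100 * k + e) * x)) (^-distribʳ-* 120 k i) ⟩
  -- Bernoulli is applied at n/k = 100, where 4n/k is 400. The padding 3120 e raises 880 (100 k + e)
  -- to 400 (220 k + 10 e), the linear form that matches ten powers.
  220 * (4 * (100 * k + e) * (120 ^ i * k ^ i))       ≤⟨ m≤m+n _ (3120 * e * (120 ^ i * k ^ i)) ⟩
  220 * (4 * (100 * k + e) * (120 ^ i * k ^ i)) + 3120 * e * (120 ^ i * k ^ i) ≡⟨ lemma₁ k e (120 ^ i) (k ^ i) ⟩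
  400 * 120 ^ i * (k ^ i * (220 * k + 10 * e))        ≤⟨ *-mono-≤ h (*-monoʳ-≤ (k ^ i) (+-monoʳ-≤ (220 * k) (*-monoˡ-≤ e 10≤i))) ⟩
  220 ^ i * (k ^ i * (220 * k + i * e))               ≡⟨ *-assoc (220 ^ i) (k ^ i) _ ⟨
  220 ^ i * k ^ i * (220 * k + i * e)                 ≡⟨ cong (_* (220 * k + i * e)) (^-distribʳ-* 220 k i) ⟨
  (220 * k) ^ i * (220 * k + i * e)                   ≤⟨ [1+x]^j≥1+jx e (220 * k) i ⟩
  (220 * k + e) ^ i * (220 * k)                       ≡⟨ cong (λ x → x ^ i * (220 * k)) (lemma₂ k e) ⟩
  (120 * k + (100 * k + e)) ^ i * (220 * k)           ≡⟨ lemma₃ ((120 * k + (100 * k + e)) ^ i) k ⟩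
  220 * (k * (120 * k + (100 * k + e)) ^ i)           ∎)
  where
  lemma₁ : ∀ k e x y → 220 * (4 * (100 * k + e) * (x * y)) + 3120 * e * (x * y) ≡ 400 * x * (y * (220 * k + 10 * e))
  lemma₁ = solve-∀
  lemma₂ : ∀ k e → 220 * k + e ≡ 120 * k + (100 * k + e)
  lemma₂ = solve-∀
  lemma₃ : ∀ x k → x * (220 * k) ≡ 220 * (k * x)
  lemma₃ = solve-∀

module _ (n k j : ℕ) .{{_ : NonZero k}} .{{_ : NonZero j}} (100k≤n : 100 * k ≤ n) where

  private
    b = 120 * (j * k)

    -- Bernoulli bounds (1 + n/120jk)^j below by 1 + n/120k, so `j`, and with it `d`, disappears
    -- from what remains to be compared with C(n,k).
    ratio^j : b ^ j * (120 * k + n) ≤ (b + n) ^ j * (120 * k)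
    ratio^j = *-cancelˡ-≤ j (begin
      j * (b ^ j * (120 * k + n))   ≡⟨ lemma₁ j k n (b ^ j) ⟩
      b ^ j * (b + j * n)           ≤⟨ [1+x]^j≥1+jx n b j ⟩
      (b + n) ^ j * b               ≡⟨ lemma₂ j k ((b + n) ^ j) ⟩
      j * ((b + n) ^ j * (120 * k)) ∎)
      where
      lemma₁ : ∀ j k n x → j * (x * (120 * k + n)) ≡ x * (120 * (j * k) + j * n)
      lemma₁ = solve-∀
      lemma₂ : ∀ j k x → x * (120 * (j * k)) ≡ j * (x * (120 * k))
      lemma₂ = solve-∀

    ratio^10j : ∀ i → 4 * n * (120 * k) ^ i ≤ k * (120 * k + n) ^ i →
      b ^ (j * i) * (4 * n) ≤ (b + n) ^ (j * i) * k
    ratio^10j i h = *-cancelʳ-≤ _ _ ((120 * k) ^ i) {{m^n≢0 (120 * k) i {{m*n≢0 120 k}}}} (begin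
      b ^ (j * i) * (4 * n) * (120 * k) ^ i           ≡⟨ *-assoc (b ^ (j * i)) (4 * n) _ ⟩
      b ^ (j * i) * (4 * n * (120 * k) ^ i)           ≤⟨ *-monoʳ-≤ (b ^ (j * i)) h ⟩
      b ^ (j * i) * (k * (120 * k + n) ^ i)           ≡⟨ cong (_* (k * (120 * k + n) ^ i)) (^-*-assoc b j i) ⟨
      (b ^ j) ^ i * (k * (120 * k + n) ^ i)           ≡⟨ lemma₁ ((b ^ j) ^ i) k ((120 * k + n) ^ i) ⟩
      k * ((b ^ j) ^ i * (120 * k + n) ^ i)           ≡⟨ cong (k *_) (^-distribʳ-* (b ^ j) (120 * k + n) i) ⟨
      k * (b ^ j * (120 * k + n)) ^ i                 ≤⟨ *-monoʳ-≤ k (^-monoˡ-≤ i ratio^j) ⟩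
      k * ((b + n) ^ j * (120 * k)) ^ i               ≡⟨ cong (k *_) (^-distribʳ-* ((b + n) ^ j) (120 * k) i) ⟩
      k * (((b + n) ^ j) ^ i * (120 * k) ^ i)         ≡⟨ cong (λ x → k * (x * (120 * k) ^ i)) (^-*-assoc (b + n) j i) ⟩
      k * ((b + n) ^ (j * i) * (120 * k) ^ i)         ≡⟨ lemma₂ k ((b + n) ^ (j * i)) ((120 * k) ^ i) ⟩
      (b + n) ^ (j * i) * k * (120 * k) ^ i           ∎)
      where
      lemma₁ : ∀ x k y → x * (k * y) ≡ k * (x * y)
      lemma₁ = solve-∀
      lemma₂ : ∀ k x y → k * (x * y) ≡ x * k * y
      lemma₂ = solve-∀

  -- Ten such j-th powers reach (1 + n/120k)^10 ≥ 4n/k, and the k-th power of 4n/k dominates C(n,k).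
  binomial-growth : b ^ (j * 10 * k) * (n C k) ≤ (b + n) ^ (j * 10 * k)
  binomial-growth = go (j * 10) (ratio^10j 10 (4n*[120k]^i≤k*[120k+n]^i 10 ≤-refl (≤ᵇ⇒≤ (400 * 120 ^ 10) (220 ^ 10) _) n k 100k≤n))
    where
    go : ∀ i → b ^ i * (4 * n) ≤ (b + n) ^ i * k → b ^ (i * k) * (n C k) ≤ (b + n) ^ (i * k)
    go i h = *-cancelʳ-≤ _ _ (k ^ k) {{m^n≢0 k k}} (begin
      b ^ (i * k) * (n C k) * k ^ k       ≡⟨ *-assoc (b ^ (i * k)) (n C k) _ ⟩
      b ^ (i * k) * ((n C k) * k ^ k)     ≤⟨ *-monoʳ-≤ (b ^ (i * k)) (nCk*k^k≤[4n]^k n k) ⟩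
      b ^ (i * k) * (4 * n) ^ k           ≡⟨ cong (_* (4 * n) ^ k) (^-*-assoc b i k) ⟨
      (b ^ i) ^ k * (4 * n) ^ k           ≡⟨ ^-distribʳ-* (b ^ i) (4 * n) k ⟨
      (b ^ i * (4 * n)) ^ k               ≤⟨ ^-monoˡ-≤ k h ⟩
      ((b + n) ^ i * k) ^ k               ≡⟨ ^-distribʳ-* ((b + n) ^ i) k k ⟩
      ((b + n) ^ i) ^ k * k ^ k           ≡⟨ cong (_* k ^ k) (^-*-assoc (b + n) i k) ⟩
      (b + n) ^ (i * k) * k ^ k           ∎)

  binomial²-growth : b ^ (20 * (j * k)) * ((n C k) * (n C k)) ≤ (b + n) ^ (20 * (j * k))
  binomial²-growth = subst (λ g → b ^ g * ((n C k) * (n C k)) ≤ (b + n) ^ g) (lemma₂ j k) (begin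
    b ^ (g + g) * ((n C k) * (n C k))              ≡⟨ cong (_* ((n C k) * (n C k))) (^-distribˡ-+-* b g g) ⟩
    b ^ g * b ^ g * ((n C k) * (n C k))            ≡⟨ lemma (b ^ g) (n C k) ⟩
    b ^ g * (n C k) * (b ^ g * (n C k))            ≤⟨ *-mono-≤ binomial-growth binomial-growth ⟩
    (b + n) ^ g * (b + n) ^ g                      ≡⟨ ^-distribˡ-+-* (b + n) g g ⟨
    (b + n) ^ (g + g)                              ∎)
    where
    g = j * 10 * k
    lemma : ∀ x y → x * x * (y * y) ≡ x * y * (x * y)
    lemma = solve-∀
    lemma₂ : ∀ j k → j * 10 * k + j * 10 * k ≡ 20 * (j * k)
    lemma₂ = solve-∀

∃-scaled-√ : ∀ c d → .{{_ : NonZero c}} → ∃ λ j → c * (j * j) ≤ d × d < c * (suc j * suc j)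
∃-scaled-√ c zero    = 0 , ≤-reflexive (*-zeroʳ c) , ≤-trans (>-nonZero⁻¹ c) (≤-reflexive (sym (*-identityʳ c)))
∃-scaled-√ c (suc d) with ∃-scaled-√ c d
... | j , cj²≤d , d<c[1+j]² with c * (suc j * suc j) ≤? suc d
... | no  ≰sd = j , ≤-trans cj²≤d (n≤1+n d) , ≰⇒> ≰sd
... | yes ≤sd = suc j , ≤sd , ≤-trans (s≤s d<c[1+j]²) (*-monoʳ-< c (*-mono-< (n<1+n (suc j)) (n<1+n (suc j))))

-- The first summand is the loss in the Chernoff exponent, the second is what
-- remains to beat C(n,k)².
exponent-budget : ∀ n m k j d B → n ≡ k + m → 100 * k ≤ n → 10 ≤ j → d ≤ 3600 * (suc j * suc j) →
  120 * (j * k) ≤ B →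
  n * (d * triangle k) + 20 * (j * k) * (B * pred n) ≤ B * (45 * (j * k * m))
exponent-budget n m k j d B refl 100k≤n 10≤j d≤ b≤B = begin
  -- In units of B j k, the moment bound costs 19 n and the target 20 n, while the deviation
  -- provides 45 m.
  n * (d * triangle k) + 20 * (j * k) * (B * pred n)
    ≤⟨ +-mono-≤ loss (*-monoʳ-≤ (20 * (j * k)) (*-monoʳ-≤ B (pred[n]≤n {n}))) ⟩
  19 * (B * (j * k) * n) + 20 * (j * k) * (B * n)
    ≡⟨ lemma₁ B (j * k) n ⟩
  B * (j * k * (39 * n))
    ≤⟨ *-monoʳ-≤ B (*-monoʳ-≤ (j * k) 39n≤45m) ⟩
  B * (j * k * (45 * m))
    ≡⟨ lemma₂ B (j * k) m ⟩
  B * (45 * (j * k * m)) ∎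
  where
  lemma₁ : ∀ B x n → 19 * (B * x * n) + 20 * x * (B * n) ≡ B * (x * (39 * n))
  lemma₁ = solve-∀
  lemma₂ : ∀ B x m → B * (x * (45 * m)) ≡ B * (45 * (x * m))
  lemma₂ = solve-∀
  99k≤m : 99 * k ≤ m
  99k≤m = +-cancelˡ-≤ k (99 * k) m 100k≤n
  39n≤45m : 39 * (k + m) ≤ 45 * m
  39n≤45m = begin
    -- 555 = 6 * 99 - 39, so the padded terms in k add up to 6 * 99 k, which is at most 6 m.
    39 * (k + m)           ≤⟨ m≤m+n _ (555 * k) ⟩
    39 * (k + m) + 555 * k ≡⟨ lemma₃ k m ⟩
    6 * (99 * k) + 39 * m  ≤⟨ +-monoˡ-≤ (39 * m) (*-monoʳ-≤ 6 99k≤m) ⟩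
    6 * m + 39 * m         ≡⟨ *-distribʳ-+ m 6 39 ⟨
    45 * m                 ∎
    where
    lemma₃ : ∀ k m → 39 * (k + m) + 555 * k ≡ 6 * (99 * k) + 39 * m
    lemma₃ = solve-∀
  2τ≤k² : ∀ k → triangle k + triangle k ≤ k * k
  2τ≤k² zero    = z≤n
  2τ≤k² (suc k) = ≤-trans (≤-reflexive (triangle-double k)) (*-monoˡ-≤ (suc k) (n≤1+n k))
  -- Rounding the root down costs at most a factor 1.21 in `d` once j ≥ 10, and 3600 * 1.21 = 4356.
  10[1+j]≤11j : 10 * suc j ≤ 11 * j
  10[1+j]≤11j = begin
    10 * suc j    ≡⟨ *-suc 10 j ⟩
    10 + 10 * j   ≤⟨ +-monoˡ-≤ (10 * j) 10≤j ⟩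
    11 * j        ∎
  d≤4356j² : d ≤ 4356 * (j * j)
  d≤4356j² = begin
    d                              ≤⟨ d≤ ⟩
    3600 * (suc j * suc j)         ≡⟨ lemma₄ (suc j) ⟩
    36 * (10 * suc j * (10 * suc j)) ≤⟨ *-monoʳ-≤ 36 (*-mono-≤ 10[1+j]≤11j 10[1+j]≤11j) ⟩
    36 * (11 * j * (11 * j))       ≡⟨ lemma₅ j ⟩
    4356 * (j * j)                 ∎
    where
    lemma₄ : ∀ j → 3600 * (j * j) ≡ 36 * (10 * j * (10 * j))
    lemma₄ = solve-∀
    lemma₅ : ∀ j → 36 * (11 * j * (11 * j)) ≡ 4356 * (j * j)
    lemma₅ = solve-∀
  loss : n * (d * triangle k) ≤ 19 * (B * (j * k) * n)
  loss = *-cancelˡ-≤ 2 (begin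
    2 * (n * (d * triangle k))                     ≡⟨ lemma₆ n d (triangle k) ⟩
    n * (d * (triangle k + triangle k))            ≤⟨ *-monoʳ-≤ n (*-mono-≤ d≤4356j² (2τ≤k² k)) ⟩
    -- 4356 + 204 = 38 * 120: the padding brings out the factor `120 * (j * k)`, which `B`
    -- dominates.
    n * (4356 * (j * j) * (k * k))                 ≤⟨ m≤m+n _ (204 * (n * (j * j * (k * k)))) ⟩
    n * (4356 * (j * j) * (k * k)) + 204 * (n * (j * j * (k * k))) ≡⟨ lemma₇ n j k ⟩
    38 * (120 * (j * k) * (j * k) * n)             ≤⟨ *-monoʳ-≤ 38 (*-monoˡ-≤ n (*-monoˡ-≤ (j * k) b≤B)) ⟩
    38 * (B * (j * k) * n)                         ≡⟨ *-assoc 2 19 (B * (j * k) * n) ⟩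
    2 * (19 * (B * (j * k) * n))                   ∎)
    where
    lemma₆ : ∀ n d t → 2 * (n * (d * t)) ≡ n * (d * (t + t))
    lemma₆ = solve-∀
    lemma₇ : ∀ n j k → n * (4356 * (j * j) * (k * k)) + 204 * (n * (j * j * (k * k))) ≡ 38 * (120 * (j * k) * (j * k) * n)
    lemma₇ = solve-∀

-- Tail bounds for d independent matchings

module _ {A : Set} where

  vecProduct : (A → ℕ) → ∀ {d} → Vec A d → ℕ
  vecProduct φ []      = 1
  vecProduct φ (x ∷ v) = φ x * vecProduct φ v

  sum-map-+ : ∀ (f g : A → ℕ) xs → sum (map (λ x → f x + g x) xs) ≡ sum (map f xs) + sum (map g xs)
  sum-map-+ f g []       = refl
  sum-map-+ f g (x ∷ xs) = begin-equality
    f x + g x + sum (map (λ x → f x + g x) xs)          ≡⟨ cong (f x + g x +_) (sum-map-+ f g xs) ⟩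
    f x + g x + (sum (map f xs) + sum (map g xs))       ≡⟨ lemma (f x) (g x) (sum (map f xs)) (sum (map g xs)) ⟩
    f x + sum (map f xs) + (g x + sum (map g xs))       ∎
    where
    lemma : ∀ a b c d → a + b + (c + d) ≡ a + c + (b + d)
    lemma = solve-∀

  sum-map-const : ∀ c (xs : List A) → sum (map (λ _ → c) xs) ≡ length xs * c
  sum-map-const c []       = refl
  sum-map-const c (x ∷ xs) = cong (c +_) (sum-map-const c xs)

  sum-map-*ʳ : ∀ a (f : A → ℕ) xs → sum (map (λ x → f x * a) xs) ≡ sum (map f xs) * a
  sum-map-*ʳ a f xs = begin-equality
    sum (map (λ x → f x * a) xs)   ≡⟨ cong sum (map-cong (λ x → *-comm (f x) a) xs) ⟩
    sum (map (λ x → a * f x) xs)   ≡⟨ sum-map-*ˡ a f xs ⟩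
    a * sum (map f xs)             ≡⟨ *-comm a _ ⟩
    sum (map f xs) * a             ∎

  sum-map-allVecs : ∀ {d} (F : Vec A (suc d) → ℕ) (xs ys : List A) →
    sum (map F (concatMap (λ x → map (x ∷_) (allVecs ys d)) xs)) ≡
    sum (map (λ x → sum (map (λ v → F (x ∷ v)) (allVecs ys d))) xs)
  sum-map-allVecs F []       ys = refl
  sum-map-allVecs {d} F (x ∷ xs) ys = trans
    (sum-map-++ F (map (x ∷_) (allVecs ys d)) _)
    (cong₂ _+_ (cong sum (sym (map-∘ (allVecs ys d)))) (sum-map-allVecs F xs ys))

  -- This is where the independence of the d matchings enters: over all tuples, the sum of products
  -- factorises.
  sum-vecProduct : ∀ (φ : A → ℕ) xs d → sum (map (vecProduct φ) (allVecs xs d)) ≡ sum (map φ xs) ^ d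
  sum-vecProduct φ xs zero    = refl
  sum-vecProduct φ xs (suc d) = begin-equality
    sum (map (vecProduct φ) (allVecs xs (suc d)))
      ≡⟨ sum-map-allVecs (vecProduct φ) xs xs ⟩
    sum (map (λ x → sum (map (λ v → φ x * vecProduct φ v) (allVecs xs d))) xs)
      ≡⟨ cong sum (map-cong (λ x → trans (sum-map-*ˡ (φ x) (vecProduct φ) (allVecs xs d)) (cong (φ x *_) (sum-vecProduct φ xs d))) xs) ⟩
    sum (map (λ x → φ x * sum (map φ xs) ^ d) xs)
      ≡⟨ sum-map-*ʳ (sum (map φ xs) ^ d) φ xs ⟩
    sum (map φ xs) * sum (map φ xs) ^ d ∎

  length-allVecs : ∀ (xs : List A) d → length (allVecs xs d) ≡ length xs ^ d
  length-allVecs xs zero    = refl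
  length-allVecs xs (suc d) = go xs
    where
    go : ∀ ys → length (concatMap (λ x → map (x ∷_) (allVecs xs d)) ys) ≡ length ys * length xs ^ d
    go []       = refl
    go (y ∷ ys) = trans (length-++ (map (y ∷_) (allVecs xs d)))
      (cong₂ _+_ (trans (length-map (y ∷_) (allVecs xs d)) (length-allVecs xs d)) (go ys))

  All-allVecs : ∀ {P : A → Set} (Q : ∀ d → Vec A d → Set) → Q 0 [] →
    (∀ d x v → P x → Q d v → Q (suc d) (x ∷ v)) → ∀ {xs} → All P xs → ∀ d → All (Q d) (allVecs xs d)
  All-allVecs Q q[] q∷ pxs zero    = q[] ∷ []
  All-allVecs Q q[] q∷ pxs (suc d) = All.concat⁺ (All.map⁺
    (All.map (λ px → All.map⁺ (All.map (q∷ d _ _ px) (All-allVecs Q q[] q∷ pxs d))) pxs))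

  -- For Markov's inequality below: when every weight is replaced by the least one, the sum is
  -- bounded by a product, whose X-th power can be taken factor by factor.
  ∃-min : ∀ (w : A → ℕ) y ys → ∃ λ y₀ → y₀ ∈ y ∷ ys × All (λ z → w y₀ ≤ w z) (y ∷ ys)
  ∃-min w y []        = y , here refl , ≤-refl ∷ []
  ∃-min w y (y′ ∷ ys) with ∃-min w y′ ys
  ... | y₀ , y₀∈ , min with ≤-total (w y) (w y₀)
  ... | inj₁ y≤y₀ = y , here refl , ≤-refl ∷ All.map (≤-trans y≤y₀) min
  ... | inj₂ y₀≤y = y₀ , there y₀∈ , y₀≤y ∷ min

  length*min≤sum : ∀ {w : A → ℕ} {c ys} → All (λ z → c ≤ w z) ys → length ys * c ≤ sum (map w ys)
  length*min≤sum []       = z≤n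
  length*min≤sum (p ∷ ps) = +-mono-≤ p (length*min≤sum ps)

  -- Markov's inequality for a threshold that is only known through its X-th power.
  markov-^ : ∀ (w : A → ℕ) X Z U ys → .{{_ : NonZero X}} →
    All (λ y → Z ≤ w y ^ X * U) ys → length ys ^ X * Z ≤ sum (map w ys) ^ X * U
  markov-^ w (suc X) Z U []       _  = z≤n
  markov-^ w X       Z U (y ∷ ys) ps with (y₀ , y₀∈ , min) ← ∃-min w y ys = begin
    l ^ X * Z                        ≤⟨ *-monoʳ-≤ (l ^ X) (All.lookup ps y₀∈) ⟩
    l ^ X * (w y₀ ^ X * U)           ≡⟨ *-assoc (l ^ X) (w y₀ ^ X) U ⟨
    l ^ X * w y₀ ^ X * U             ≡⟨ cong (_* U) (^-distribʳ-* l (w y₀) X) ⟨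
    (l * w y₀) ^ X * U               ≤⟨ *-monoˡ-≤ U (^-monoˡ-≤ X (length*min≤sum min)) ⟩
    sum (map w (y ∷ ys)) ^ X * U     ∎
    where l = length (y ∷ ys)

  module _ {P : A → Set} (P? : Decidable P) where

    sum-filter-≤ : ∀ (w : A → ℕ) xs → sum (map w (filter P? xs)) ≤ sum (map w xs)
    sum-filter-≤ w []       = z≤n
    sum-filter-≤ w (x ∷ xs) with does (P? x)
    ... | true  = +-monoʳ-≤ (w x) (sum-filter-≤ w xs)
    ... | false = ≤-trans (sum-filter-≤ w xs) (m≤n+m _ (w x))

  length-filter-⊎ : ∀ (φ : A → Bool) {P Q : A → Set} (P? : Decidable P) (Q? : Decidable Q) →
    (∀ x → φ x ≡ true → P x ⊎ Q x) → ∀ xs →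
    length (filterᵇ φ xs) ≤ length (filter P? xs) + length (filter Q? xs)
  length-filter-⊎ φ P? Q? h []       = z≤n
  length-filter-⊎ φ P? Q? h (x ∷ xs) with ih ← length-filter-⊎ φ P? Q? h xs | φ x in eq | P? x | Q? x
  ... | false | no _   | no _   = ih
  ... | false | yes _  | no _   = m≤n⇒m≤1+n ih
  ... | false | no _   | yes _  = ≤-trans ih (+-monoʳ-≤ _ (n≤1+n _))
  ... | false | yes _  | yes _  = m≤n⇒m≤1+n (≤-trans ih (+-monoʳ-≤ _ (n≤1+n _)))
  ... | true  | yes _  | no _   = s≤s ih
  ... | true  | no _   | yes _  = ≤-trans (s≤s ih) (≤-reflexive (sym (+-suc _ _)))
  ... | true  | yes _  | yes _  = s≤s (≤-trans ih (+-monoʳ-≤ _ (n≤1+n _)))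
  ... | true  | no ¬p  | no ¬q with h x eq
  ... | inj₁ p = contradiction p ¬p
  ... | inj₂ q = contradiction q ¬q

∣m-n∣≤ : ∀ {m n o} → m ≤ n + o → n ≤ m + o → ∣ m - n ∣ ≤ o
∣m-n∣≤ {m} {n} {o} m≤ n≤ with ≤-total m n
... | inj₁ m≤n = ≤-trans (≤-reflexive (m≤n⇒∣m-n∣≡n∸m m≤n)) (m≤n+o⇒m∸n≤o n m n≤)
... | inj₂ n≤m = ≤-trans (≤-reflexive (m≤n⇒∣n-m∣≡n∸m n≤m)) (m≤n+o⇒m∸n≤o m n m≤)

module _ (B c D X : ℕ) .{{_ : NonZero B}} where

  -- Since κ = D - 2I, the weight is B^D (c/B)^I; this is its X-th power without denominators.
  weight-identity : ∀ {w} κ I → κ + (I + I) ≡ D → w ≡ B ^ κ * (B * c) ^ I →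
    w ^ X * B ^ (I * X) ≡ B ^ (D * X) * c ^ (I * X)
  weight-identity {w} κ I refl refl = begin-equality
    w ^ X * B ^ (I * X)                           ≡⟨ cong (w ^ X *_) (^-*-assoc B I X) ⟨
    w ^ X * (B ^ I) ^ X                           ≡⟨ ^-distribʳ-* w (B ^ I) X ⟨
    (B ^ κ * (B * c) ^ I * B ^ I) ^ X             ≡⟨ cong (λ x → (B ^ κ * x * B ^ I) ^ X) (^-distribʳ-* B c I) ⟩
    (B ^ κ * (B ^ I * c ^ I) * B ^ I) ^ X         ≡⟨ cong (_^ X) (lemma (B ^ κ) (B ^ I) (c ^ I)) ⟩
    (B ^ κ * (B ^ I * B ^ I) * c ^ I) ^ X         ≡⟨ cong (λ x → (B ^ κ * x * c ^ I) ^ X) (^-distribˡ-+-* B I I) ⟨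
    (B ^ κ * B ^ (I + I) * c ^ I) ^ X             ≡⟨ cong (λ x → (x * c ^ I) ^ X) (^-distribˡ-+-* B κ (I + I)) ⟨
    (B ^ (κ + (I + I)) * c ^ I) ^ X               ≡⟨ ^-distribʳ-* (B ^ (κ + (I + I))) (c ^ I) X ⟩
    (B ^ (κ + (I + I))) ^ X * (c ^ I) ^ X         ≡⟨ cong₂ _*_ (^-*-assoc B (κ + (I + I)) X) (^-*-assoc c I X) ⟩
    B ^ ((κ + (I + I)) * X) * c ^ (I * X)         ∎
    where
    lemma : ∀ x y z → x * (y * z) * y ≡ x * (y * y) * z
    lemma = solve-∀

  weight-≥-high : ∀ {w} κ I e → κ + (I + I) ≡ D → w ≡ B ^ κ * (B * c) ^ I → B ≤ c → e ≤ I * X →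
    B ^ (D * X) * c ^ e ≤ w ^ X * B ^ e
  weight-≥-high {w} κ I e par w≡ B≤c e≤IX with (r , e+r≡) ← m≤n⇒∃[o]m+o≡n e≤IX =
    *-cancelʳ-≤ _ _ (B ^ r) {{m^n≢0 B r}} (begin
      B ^ (D * X) * c ^ e * B ^ r       ≤⟨ *-monoʳ-≤ (B ^ (D * X) * c ^ e) (^-monoˡ-≤ r B≤c) ⟩
      B ^ (D * X) * c ^ e * c ^ r       ≡⟨ collect (B ^ (D * X)) c ⟩
      B ^ (D * X) * c ^ (I * X)         ≡⟨ weight-identity κ I par w≡ ⟨
      w ^ X * B ^ (I * X)               ≡⟨ collect (w ^ X) B ⟨
      w ^ X * B ^ e * B ^ r             ∎)
    where
    collect : ∀ a x → a * x ^ e * x ^ r ≡ a * x ^ (I * X)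
    collect a x = trans (*-assoc a _ _) (cong (a *_) (trans (sym (^-distribˡ-+-* x e r)) (cong (x ^_) e+r≡)))

  -- With c ≤ B, fewer internal edges mean a larger weight: (c/B)^(IX) ≥ (c/B)^(e - F). The
  -- difference e - F is avoided by placing the powers with exponent F on opposite sides.
  weight-≥-low : ∀ {w} κ I e F → κ + (I + I) ≡ D → w ≡ B ^ κ * (B * c) ^ I → c ≤ B → I * X + F ≤ e →
    B ^ (D * X) * (c ^ e * B ^ F) ≤ w ^ X * (B ^ e * c ^ F)
  weight-≥-low {w} κ I e F par w≡ c≤B IX+F≤e with (r , refl) ← m≤n⇒∃[o]m+o≡n IX+F≤e = begin
    B ^ (D * X) * (c ^ (I * X + F + r) * B ^ F)
      ≡⟨ cong (λ x → B ^ (D * X) * (x * B ^ F)) (collect c) ⟩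
    B ^ (D * X) * (c ^ (I * X) * c ^ F * c ^ r * B ^ F)
      ≡⟨ lemma₁ (B ^ (D * X)) (c ^ (I * X)) (c ^ F) (c ^ r) (B ^ F) ⟩
    B ^ (D * X) * c ^ (I * X) * (c ^ F * B ^ F) * c ^ r
      ≤⟨ *-monoʳ-≤ (B ^ (D * X) * c ^ (I * X) * (c ^ F * B ^ F)) (^-monoˡ-≤ r c≤B) ⟩
    B ^ (D * X) * c ^ (I * X) * (c ^ F * B ^ F) * B ^ r
      ≡⟨ cong (λ x → x * (c ^ F * B ^ F) * B ^ r) (weight-identity κ I par w≡) ⟨
    w ^ X * B ^ (I * X) * (c ^ F * B ^ F) * B ^ r
      ≡⟨ lemma₂ (w ^ X) (B ^ (I * X)) (B ^ F) (B ^ r) (c ^ F) ⟩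
    w ^ X * (B ^ (I * X) * B ^ F * B ^ r * c ^ F)
      ≡⟨ cong (λ x → w ^ X * (x * c ^ F)) (collect B) ⟨
    w ^ X * (B ^ (I * X + F + r) * c ^ F) ∎
    where
    collect : ∀ x → x ^ (I * X + F + r) ≡ x ^ (I * X) * x ^ F * x ^ r
    collect x = trans (^-distribˡ-+-* x (I * X + F) r) (cong (_* x ^ r) (^-distribˡ-+-* x (I * X) F))
    lemma₁ : ∀ a b c d e → a * (b * c * d * e) ≡ a * b * (c * e) * d
    lemma₁ = solve-∀
    lemma₂ : ∀ a b c d e → a * b * (e * c) * d ≡ a * (b * c * d * e)
    lemma₂ = solve-∀

-- σ is the total weight of all samples, cnt the number of deviating ones, and
-- F the exponent gained over the moment generating function bound.
module _ (B c D X e F cnt σ T : ℕ) .{{_ : NonZero B}} .{{_ : NonZero c}}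
  (σ-bound : σ ^ X * B ^ e ≤ (B ^ D * T) ^ X * c ^ e) where

  private
    expand : (B ^ D * T) ^ X ≡ B ^ (D * X) * T ^ X
    expand = trans (^-distribʳ-* (B ^ D) T X) (cong (_* T ^ X) (^-*-assoc B D X))

  chernoff-high : cnt ^ X * (B ^ (D * X) * c ^ (e + F)) ≤ σ ^ X * B ^ (e + F) → cnt ^ X * c ^ F ≤ T ^ X * B ^ F
  chernoff-high h = *-cancelˡ-≤ (B ^ (D * X) * c ^ e) {{m*n≢0 _ _ {{m^n≢0 B (D * X)}} {{m^n≢0 c e}}}} (begin
    B ^ (D * X) * c ^ e * (cnt ^ X * c ^ F)       ≡⟨ lemma₁ (B ^ (D * X)) (c ^ e) (cnt ^ X) (c ^ F) ⟩
    cnt ^ X * (B ^ (D * X) * (c ^ e * c ^ F))     ≡⟨ cong (λ x → cnt ^ X * (B ^ (D * X) * x)) (^-distribˡ-+-* c e F) ⟨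
    cnt ^ X * (B ^ (D * X) * c ^ (e + F))         ≤⟨ h ⟩
    σ ^ X * B ^ (e + F)                           ≡⟨ cong (σ ^ X *_) (^-distribˡ-+-* B e F) ⟩
    σ ^ X * (B ^ e * B ^ F)                       ≡⟨ *-assoc (σ ^ X) (B ^ e) _ ⟨
    σ ^ X * B ^ e * B ^ F                         ≤⟨ *-monoˡ-≤ (B ^ F) σ-bound ⟩
    (B ^ D * T) ^ X * c ^ e * B ^ F               ≡⟨ cong (λ x → x * c ^ e * B ^ F) expand ⟩
    B ^ (D * X) * T ^ X * c ^ e * B ^ F           ≡⟨ lemma₂ (B ^ (D * X)) (T ^ X) (c ^ e) (B ^ F) ⟩
    B ^ (D * X) * c ^ e * (T ^ X * B ^ F)         ∎)
    where
    lemma₁ : ∀ a b c d → a * b * (c * d) ≡ c * (a * (b * d))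
    lemma₁ = solve-∀
    lemma₂ : ∀ a b c d → a * b * c * d ≡ a * c * (b * d)
    lemma₂ = solve-∀

  chernoff-low : cnt ^ X * (B ^ (D * X) * (c ^ e * B ^ F)) ≤ σ ^ X * (B ^ e * c ^ F) → cnt ^ X * B ^ F ≤ T ^ X * c ^ F
  chernoff-low h = *-cancelˡ-≤ (B ^ (D * X) * c ^ e) {{m*n≢0 _ _ {{m^n≢0 B (D * X)}} {{m^n≢0 c e}}}} (begin
    B ^ (D * X) * c ^ e * (cnt ^ X * B ^ F)       ≡⟨ lemma₁ (B ^ (D * X)) (c ^ e) (cnt ^ X) (B ^ F) ⟩
    cnt ^ X * (B ^ (D * X) * (c ^ e * B ^ F))     ≤⟨ h ⟩
    σ ^ X * (B ^ e * c ^ F)                       ≡⟨ *-assoc (σ ^ X) (B ^ e) _ ⟨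
    σ ^ X * B ^ e * c ^ F                         ≤⟨ *-monoˡ-≤ (c ^ F) σ-bound ⟩
    (B ^ D * T) ^ X * c ^ e * c ^ F               ≡⟨ cong (λ x → x * c ^ e * c ^ F) expand ⟩
    B ^ (D * X) * T ^ X * c ^ e * c ^ F           ≡⟨ lemma₂ (B ^ (D * X)) (T ^ X) (c ^ e) (c ^ F) ⟩
    B ^ (D * X) * c ^ e * (T ^ X * c ^ F)         ∎)
    where
    lemma₁ : ∀ a b c d → a * b * (c * d) ≡ c * (a * (b * d))
    lemma₁ = solve-∀
    lemma₂ : ∀ a b c d → a * b * c * d ≡ a * c * (b * d)
    lemma₂ = solve-∀

-- The gained exponent is a multiple `g * X` of the clearing power, so the X-th root is exact and
-- leaves cnt/T ≤ (lo/hi)^g ≤ 1/Δ.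
tail-bound : ∀ lo hi g X cnt T Δ → .{{_ : NonZero X}} → .{{_ : NonZero lo}} →
  lo ^ g * Δ ≤ hi ^ g → cnt ^ X * hi ^ (g * X) ≤ T ^ X * lo ^ (g * X) → cnt * Δ ≤ T
tail-bound lo hi g X cnt T Δ h₁ h₂ = ^-cancelˡ-≤ X (*-cancelʳ-≤ _ _ (lo ^ (g * X)) {{m^n≢0 lo (g * X)}} (begin
  (cnt * Δ) ^ X * lo ^ (g * X)          ≡⟨ cong₂ _*_ (^-distribʳ-* cnt Δ X) (sym (^-*-assoc lo g X)) ⟩
  cnt ^ X * Δ ^ X * (lo ^ g) ^ X        ≡⟨ lemma (cnt ^ X) (Δ ^ X) ((lo ^ g) ^ X) ⟩
  cnt ^ X * ((lo ^ g) ^ X * Δ ^ X)      ≡⟨ cong (cnt ^ X *_) (^-distribʳ-* (lo ^ g) Δ X) ⟨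
  cnt ^ X * (lo ^ g * Δ) ^ X            ≤⟨ *-monoʳ-≤ (cnt ^ X) (^-monoˡ-≤ X h₁) ⟩
  cnt ^ X * (hi ^ g) ^ X                ≡⟨ cong (cnt ^ X *_) (^-*-assoc hi g X) ⟩
  cnt ^ X * hi ^ (g * X)                ≤⟨ h₂ ⟩
  T ^ X * lo ^ (g * X)                  ∎))
  where
  lemma : ∀ x y z → x * y * z ≡ x * (z * y)
  lemma = solve-∀

-- From internal edges back to the cut

module _ (d k m K Θ : ℕ) (k+m≡1+K : k + m ≡ suc K) where

  private
    τ = triangle k

    -- Both sides equal d k K. As d k m and d τ are K times the means of the cut and of I, a
    -- deviation Θ of I K in one direction is a deviation 2Θ of κ K in the other.
    key : ∀ κ I → κ + (I + I) ≡ d * k → κ * K + (I * K + I * K) ≡ d * (k * m) + (d * τ + d * τ)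
    key κ I par = begin-equality
      κ * K + (I * K + I * K)             ≡⟨ lemma₁ κ I K ⟩
      (κ + (I + I)) * K                   ≡⟨ cong (_* K) par ⟩
      d * k * K                           ≡⟨ *-assoc d k K ⟩
      d * (k * K)                         ≡⟨ cong (d *_) (kK k k+m≡1+K) ⟩
      d * (k * m + (τ + τ))               ≡⟨ lemma₂ d (k * m) τ ⟩
      d * (k * m) + (d * τ + d * τ)       ∎
      where
      lemma₁ : ∀ κ I K → κ * K + (I * K + I * K) ≡ (κ + (I + I)) * K
      lemma₁ = solve-∀
      lemma₂ : ∀ d x τ → d * (x + (τ + τ)) ≡ d * x + (d * τ + d * τ)
      lemma₂ = solve-∀
      lemma₃ : ∀ k m → suc k * (k + m) ≡ suc k * m + k * suc k
      lemma₃ = solve-∀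
      kK : ∀ k → k + m ≡ suc K → k * K ≡ k * m + (triangle k + triangle k)
      kK zero    _    = refl
      kK (suc k) refl = trans (lemma₃ k m) (cong (suc k * m +_) (sym (triangle-double k)))

  few-cross⇒many-internal : ∀ κ I → κ + (I + I) ≡ d * k →
    κ * K + (Θ + Θ) ≤ d * (k * m) → d * τ + Θ ≤ I * K
  few-cross⇒many-internal κ I par h = *-cancelˡ-≤ 2 (+-cancelˡ-≤ (κ * K) _ _ (begin
    κ * K + 2 * (d * τ + Θ)           ≡⟨ lemma₁ (κ * K) (d * τ) Θ ⟩
    κ * K + (Θ + Θ) + (d * τ + d * τ)     ≤⟨ +-monoˡ-≤ (d * τ + d * τ) h ⟩
    d * (k * m) + (d * τ + d * τ)                    ≡⟨ key κ I par ⟨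
    κ * K + (I * K + I * K)                          ≡⟨ lemma₂ (κ * K) (I * K) ⟩
    κ * K + 2 * (I * K)                              ∎))
    where
    lemma₁ : ∀ x y z → x + 2 * (y + z) ≡ x + (z + z) + (y + y)
    lemma₁ = solve-∀
    lemma₂ : ∀ x y → x + (y + y) ≡ x + 2 * y
    lemma₂ = solve-∀

  many-cross⇒few-internal : ∀ κ I → κ + (I + I) ≡ d * k →
    d * (k * m) + (Θ + Θ) ≤ κ * K → I * K + Θ ≤ d * τ
  many-cross⇒few-internal κ I par h = *-cancelˡ-≤ 2 (+-cancelˡ-≤ (d * (k * m)) _ _ (begin
    d * (k * m) + 2 * (I * K + Θ)         ≡⟨ lemma₁ (d * (k * m)) (I * K) Θ ⟩
    d * (k * m) + (Θ + Θ) + (I * K + I * K)   ≤⟨ +-monoˡ-≤ (I * K + I * K) h ⟩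
    κ * K + (I * K + I * K)                              ≡⟨ key κ I par ⟩
    d * (k * m) + (d * τ + d * τ)                        ≡⟨ lemma₂ (d * (k * m)) (d * τ) ⟩
    d * (k * m) + 2 * (d * τ)                            ∎))
    where
    lemma₁ : ∀ x y z → x + 2 * (y + z) ≡ x + (z + z) + (y + y)
    lemma₁ = solve-∀
    lemma₂ : ∀ x y → x + (y + y) ≡ x + 2 * y
    lemma₂ = solve-∀

-- The test in `goodᵇ` is scaled by the number of samples, the tail bounds by K. Multiplying by K²
-- turns the deviation and the mean of the one into those of the other.
relative-deviation : ∀ K x T v Σ d y g → .{{_ : NonZero K}} →
  K * x ≡ T * v → K * Σ ≡ y * T → v ≤ g → 4 * d * (g * g) ≤ 9 * (y * y) →
  4 * d * (x ^ 2) ≤ 9 * (Σ ^ 2)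
relative-deviation K x T v Σ d y g Kx≡Tv KΣ≡yT v≤g h = *-cancelˡ-≤ K (*-cancelˡ-≤ K (begin
  K * (K * (4 * d * (x ^ 2)))              ≡⟨ lemma₁ K d x ⟩
  4 * d * (K * x * (K * x))                ≡⟨ cong (λ z → 4 * d * (z * z)) Kx≡Tv ⟩
  4 * d * (T * v * (T * v))                ≤⟨ *-monoʳ-≤ (4 * d) (*-mono-≤ (*-monoʳ-≤ T v≤g) (*-monoʳ-≤ T v≤g)) ⟩
  4 * d * (T * g * (T * g))                ≡⟨ lemma₂ d T g ⟩
  T * T * (4 * d * (g * g))                ≤⟨ *-monoʳ-≤ (T * T) h ⟩
  T * T * (9 * (y * y))                    ≡⟨ lemma₃ T y ⟩
  9 * (y * T * (y * T))                    ≡⟨ cong (λ z → 9 * (z * z)) KΣ≡yT ⟨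
  9 * (K * Σ * (K * Σ))                    ≡⟨ lemma₄ K Σ ⟩
  K * (K * (9 * (Σ ^ 2)))                  ∎))
  where
  lemma₁ : ∀ K d x → K * (K * (4 * d * (x * (x * 1)))) ≡ 4 * d * (K * x * (K * x))
  lemma₁ = solve-∀
  lemma₂ : ∀ d T g → 4 * d * (T * g * (T * g)) ≡ T * T * (4 * d * (g * g))
  lemma₂ = solve-∀
  lemma₃ : ∀ T y → T * T * (9 * (y * y)) ≡ 9 * (y * T * (y * T))
  lemma₃ = solve-∀
  lemma₄ : ∀ K Σ → 9 * (K * Σ * (K * Σ)) ≡ K * (K * (9 * (Σ * (Σ * 1))))
  lemma₄ = solve-∀

module _ {n : ℕ} (d : ℕ) (S : Subset n) (k m K : ℕ) .{{_ : NonZero K}}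
  (∣S∣≡k : ∣ S ∣ ≡ k) (k+m≡n : k + m ≡ n) (n≡1+K : n ≡ suc K) (k≤m : k ≤ m) where

  private
    matchings = perfectMatchings n
    samples   = regSamples n d
    total     = length samples

    cuts↭ = cuts-perfectMatchings S ∣S∣≡k k+m≡n

  length-matchings : length matchings ≡ matchings# (suc K)
  length-matchings = begin-equality
    length matchings                                ≡⟨ length-map (cutMatching S) matchings ⟨
    length (map (cutMatching S) matchings)          ≡⟨ ↭-length cuts↭ ⟩
    length (cuts k m)                               ≡⟨ length-cuts k m ⟩
    matchings# (k + m)                              ≡⟨ cong matchings# (trans k+m≡n n≡1+K) ⟩
    matchings# (suc K)                              ∎

  mean-cutMatching : K * sum (map (cutMatching S) matchings) ≡ k * m * length matchings
  mean-cutMatching = begin-equality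
    K * sum (map (cutMatching S) matchings)           ≡⟨ cong (K *_) (sum-↭ cuts↭) ⟩
    K * sum (cuts k m)                                ≡⟨ cong (K *_) (sum-cuts k m) ⟩
    K * (k * m * matchings# (pred (pred (k + m))))    ≡⟨ cong (λ x → K * (k * m * matchings# (pred (pred x)))) (trans k+m≡n n≡1+K) ⟩
    K * (k * m * matchings# (pred K))                 ≡⟨ lemma K (k * m) (matchings# (pred K)) ⟩
    k * m * (K * matchings# (pred K))                 ≡⟨ cong (k * m *_) (trans (sym (matchings#-suc K)) (sym length-matchings)) ⟩
    k * m * length matchings                          ∎
    where
    lemma : ∀ x y z → x * (y * z) ≡ y * (x * z)
    lemma = solve-∀

  mean-cutH : K * cutSum n d S ≡ d * (k * m) * total
  mean-cutH = go d
    where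
    go : ∀ d → K * cutSum n d S ≡ d * (k * m) * length (regSamples n d)
    go zero    = *-zeroʳ K
    go (suc d) = begin-equality
      K * cutSum n (suc d) S
        ≡⟨ cong (K *_) (sum-map-allVecs (cutH S) matchings matchings) ⟩
      K * sum (map (λ x → sum (map (λ v → cutMatching S x + cutH S v) Hs)) matchings)
        ≡⟨ cong (λ x → K * sum x) (map-cong (λ x → trans (sum-map-+ (λ _ → cutMatching S x) (cutH S) Hs) (cong (_+ cutSum n d S) (trans (sum-map-const (cutMatching S x) Hs) (*-comm (length Hs) _)))) matchings) ⟩
      K * sum (map (λ x → cutMatching S x * length Hs + cutSum n d S) matchings)
        ≡⟨ cong (K *_) (trans (sum-map-+ _ _ matchings) (cong₂ _+_ (sum-map-*ʳ (length Hs) (cutMatching S) matchings) (sum-map-const (cutSum n d S) matchings))) ⟩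
      K * (sum (map (cutMatching S) matchings) * length Hs + length matchings * cutSum n d S)
        ≡⟨ lemma₁ K _ (length Hs) (length matchings) (cutSum n d S) ⟩
      K * sum (map (cutMatching S) matchings) * length Hs + length matchings * (K * cutSum n d S)
        ≡⟨ cong₂ (λ x y → x * length Hs + length matchings * y) mean-cutMatching (go d) ⟩
      k * m * length matchings * length Hs + length matchings * (d * (k * m) * length Hs)
        ≡⟨ lemma₂ (k * m) (length matchings) (length Hs) d ⟩
      suc d * (k * m) * (length matchings * length Hs)
        ≡⟨ cong (suc d * (k * m) *_) (trans (cong (length matchings *_) (length-allVecs matchings d)) (sym (length-allVecs matchings (suc d)))) ⟩
      suc d * (k * m) * length (regSamples n (suc d)) ∎
      where
      Hs = regSamples n d
      lemma₁ : ∀ K a t l c → K * (a * t + l * c) ≡ K * a * t + l * (K * c)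
      lemma₁ = solve-∀
      lemma₂ : ∀ p l t d → p * l * t + l * (d * p * t) ≡ suc d * p * (l * t)
      lemma₂ = solve-∀

  module _ (B c : ℕ) where

    edgeWeight : Vec (Fin n) n → ℕ
    edgeWeight f = weight B c k (cutMatching S f)

    -- I is the number of edges of H inside S.
    Decomposed : ∀ d → Vec (Vec (Fin n) n) d → Set
    Decomposed d H = ∃ λ I → cutH S H + (I + I) ≡ d * k × vecProduct edgeWeight H ≡ B ^ cutH S H * (B * c) ^ I

    decompose : All (Decomposed d) samples
    decompose = All-allVecs Decomposed (0 , refl , refl) step
      (All.map⁻ (All-resp-↭ (↭-sym cuts↭) (cuts-parity k m))) d
      where
      lemma₁ : ∀ x κ i I → x + κ + (i + I + (i + I)) ≡ x + (i + i) + (κ + (I + I))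
      lemma₁ = solve-∀
      lemma₂ : ∀ a b x y → a * b * (x * y) ≡ a * x * (b * y)
      lemma₂ = solve-∀
      step : ∀ d f H → (∃ λ I → cutMatching S f + (I + I) ≡ k) → Decomposed d H → Decomposed (suc d) (f ∷ H)
      step d f H (i , par) (I , par′ , w≡) = i + I ,
        trans (lemma₁ (cutMatching S f) (cutH S H) i I) (cong₂ _+_ par par′) , (begin-equality
          edgeWeight f * vecProduct edgeWeight H
            ≡⟨ cong₂ _*_ (weight-parity B c (cutMatching S f) i par) w≡ ⟩
          B ^ cutMatching S f * (B * c) ^ i * (B ^ cutH S H * (B * c) ^ I)
            ≡⟨ lemma₂ (B ^ cutMatching S f) ((B * c) ^ i) (B ^ cutH S H) ((B * c) ^ I) ⟩
          B ^ cutMatching S f * B ^ cutH S H * ((B * c) ^ i * (B * c) ^ I)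
            ≡⟨ cong₂ _*_ (^-distribˡ-+-* B (cutMatching S f) (cutH S H)) (^-distribˡ-+-* (B * c) i I) ⟨
          B ^ (cutMatching S f + cutH S H) * (B * c) ^ (i + I) ∎)

    -- The d-th power of `mgf-bound`: the total weight of all samples is the d-th power of that of a
    -- single matching.
    weight-bound : .{{_ : NonZero B}} → .{{_ : NonZero c}} →
      sum (map (vecProduct edgeWeight) samples) ^ (B * K) * B ^ (c * (d * triangle k)) ≤
      (B ^ (d * k) * total) ^ (B * K) * c ^ (c * (d * triangle k))
    weight-bound = begin
      sum (map (vecProduct edgeWeight) samples) ^ X * B ^ (c * (d * τ))
        ≡⟨ cong (λ x → x ^ X * B ^ (c * (d * τ))) (trans (sum-vecProduct edgeWeight matchings d) (cong (_^ d) V≡)) ⟩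
      (V ^ d) ^ X * B ^ (c * (d * τ))
        ≡⟨ fold V B ⟨
      (V ^ X * B ^ (c * τ)) ^ d
        ≤⟨ ^-monoˡ-≤ d (mgf-bound B c k m K k≤m (trans k+m≡n n≡1+K)) ⟩
      ((B ^ k * matchings# (suc K)) ^ X * c ^ (c * τ)) ^ d
        ≡⟨ fold (B ^ k * matchings# (suc K)) c ⟩
      ((B ^ k * matchings# (suc K)) ^ d) ^ X * c ^ (c * (d * τ))
        ≡⟨ cong (λ x → x ^ X * c ^ (c * (d * τ))) U≡ ⟩
      (B ^ (d * k) * total) ^ X * c ^ (c * (d * τ)) ∎
      where
      X = B * K
      τ = triangle k
      V = totalWeight B c k m
      V≡ : sum (map edgeWeight matchings) ≡ V
      V≡ = trans (cong sum (map-∘ matchings)) (sum-↭ (↭-map⁺ (weight B c k) cuts↭))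
      lemma : ∀ c τ d → c * τ * d ≡ c * (d * τ)
      lemma = solve-∀
      fold : ∀ V b → (V ^ X * b ^ (c * τ)) ^ d ≡ (V ^ d) ^ X * b ^ (c * (d * τ))
      fold V b = trans (^-distribʳ-* (V ^ X) (b ^ (c * τ)) d) (cong₂ _*_
        (trans (^-*-assoc V X d) (trans (cong (V ^_) (*-comm X d)) (sym (^-*-assoc V d X))))
        (trans (^-*-assoc b (c * τ) d) (cong (b ^_) (lemma c τ d))))
      U≡ : (B ^ k * matchings# (suc K)) ^ d ≡ B ^ (d * k) * total
      U≡ = trans (^-distribʳ-* (B ^ k) (matchings# (suc K)) d) (cong₂ _*_
        (trans (^-*-assoc B k d) (cong (B ^_) (*-comm k d)))
        (trans (cong (_^ d) (sym length-matchings)) (sym (length-allVecs matchings d))))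

  -- The tilt is (b + n)/b, and `growth` says that its g-th power reaches Δ. `budget` ranges over B
  -- because the upper tail of I has denominator b and the lower tail, with the inverse tilt, has b
  -- + n.
  module _ (b g Δ Θ : ℕ) .{{b≢0 : NonZero b}}
    (growth : b ^ g * Δ ≤ (b + n) ^ g)
    (budget : ∀ B → b ≤ B → n * (d * triangle k) + g * (B * K) ≤ B * Θ)
    (threshold : 4 * d * ((Θ + Θ) * (Θ + Θ)) ≤ 9 * (d * (k * m) * (d * (k * m)))) where

    private
      Sample = Vec (Vec (Fin n) n) d
      τ      = triangle k

      instance
        b+n≢0 : NonZero (b + n)
        b+n≢0 = >-nonZero (≤-trans (>-nonZero⁻¹ b) (m≤m+n b n))

      -- The names refer to crossing edges: `Few` is the upper tail of the number of internal edges,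
      -- `Many` the lower. Θ is doubled because an internal edge takes two units from the cut.
      Few Many : Sample → Set
      Few  H = cutH S H * K + (Θ + Θ) ≤ d * (k * m)
      Many H = d * (k * m) + (Θ + Θ) ≤ cutH S H * K

      few? : Decidable Few
      few? H = _ ≤? _
      many? : Decidable Many
      many? H = _ ≤? _

      -- The moment bound carries (b + n) d τ where the mean alone would give b d τ. The excess n d
      -- τ and the gain g b K are both paid for by b Θ.
      few-exponent : ∀ I → d * τ + Θ ≤ I * K → (b + n) * (d * τ) + g * (b * K) ≤ I * (b * K)
      few-exponent I h = begin
        (b + n) * (d * τ) + g * (b * K)                ≡⟨ lemma₁ b n (d * τ) (g * (b * K)) ⟩
        b * (d * τ) + (n * (d * τ) + g * (b * K))      ≤⟨ +-monoʳ-≤ (b * (d * τ)) (budget b ≤-refl) ⟩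
        b * (d * τ) + b * Θ           ≡⟨ *-distribˡ-+ b (d * τ) _ ⟨
        b * (d * τ + Θ)                 ≤⟨ *-monoʳ-≤ b h ⟩
        b * (I * K)                                    ≡⟨ lemma₂ b I K ⟩
        I * (b * K)                                    ∎
        where
        lemma₁ : ∀ b n t x → (b + n) * t + x ≡ b * t + (n * t + x)
        lemma₁ = solve-∀
        lemma₂ : ∀ b I K → b * (I * K) ≡ I * (b * K)
        lemma₂ = solve-∀

      -- With the inverse tilt the moment bound carries only b d τ. Adding n d τ to both sides
      -- completes it to (b + n) d τ and brings up the same budget, now at b + n.
      many-exponent : ∀ I → I * K + Θ ≤ d * τ → I * ((b + n) * K) + g * ((b + n) * K) ≤ b * (d * τ)
      many-exponent I h = +-cancelʳ-≤ (n * (d * τ)) _ _ (begin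
        I * (B * K) + g * (B * K) + n * (d * τ)        ≡⟨ lemma₁ I (B * K) (g * (B * K)) (n * (d * τ)) ⟩
        I * (B * K) + (n * (d * τ) + g * (B * K))      ≤⟨ +-monoʳ-≤ (I * (B * K)) (budget B (m≤m+n b n)) ⟩
        I * (B * K) + B * Θ           ≡⟨ lemma₂ I B K Θ ⟩
        B * (I * K + Θ)                 ≤⟨ *-monoʳ-≤ B h ⟩
        B * (d * τ)                                    ≡⟨ *-distribʳ-+ (d * τ) b n ⟩
        b * (d * τ) + n * (d * τ)                      ∎)
        where
        B = b + n
        lemma₁ : ∀ I x y z → I * x + y + z ≡ I * x + (z + y)
        lemma₁ = solve-∀
        lemma₂ : ∀ I B K x → I * (B * K) + B * x ≡ B * (I * K + x)
        lemma₂ = solve-∀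

      few-tail : length (filter few? (regSamples n d)) * Δ ≤ total
      few-tail = tail-bound b (b + n) g X (length Hs) total Δ {{m*n≢0 b K}} growth
        (chernoff-high b (b + n) (d * k) X e F (length Hs) σ total (weight-bound b (b + n))
          (≤-trans
            (markov-^ w X (b ^ (d * k * X) * (b + n) ^ (e + F)) (b ^ (e + F)) Hs {{m*n≢0 b K}} (All.tabulate each))
            (*-monoˡ-≤ (b ^ (e + F)) (^-monoˡ-≤ X (sum-filter-≤ few? w (regSamples n d))))))
        where
        X = b * K
        e = (b + n) * (d * τ)
        F = g * X
        Hs = filter few? (regSamples n d)
        w : Sample → ℕ
        w = vecProduct (edgeWeight b (b + n))
        σ = sum (map w (regSamples n d))
        each : ∀ {H} → H ∈ Hs → b ^ (d * k * X) * (b + n) ^ (e + F) ≤ w H ^ X * b ^ (e + F)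
        each {H} H∈ with (H∈samples , few) ← ∈-filter⁻ few? {xs = regSamples n d} H∈
          with (I , par , w≡) ← All.lookup (decompose b (b + n)) H∈samples =
          weight-≥-high b (b + n) (d * k) X (cutH S H) I (e + F) par w≡ (m≤m+n b n)
            (few-exponent I (few-cross⇒many-internal d k m K Θ (trans k+m≡n n≡1+K) (cutH S H) I par few))

      -- Here an internal edge has the factor b/(b + n) below 1, so the samples with few internal
      -- edges are the heavy ones.
      many-tail : length (filter many? (regSamples n d)) * Δ ≤ total
      many-tail = tail-bound b (b + n) g X (length Hs) total Δ {{m*n≢0 (b + n) K}} growth
        (chernoff-low (b + n) b (d * k) X e F (length Hs) σ total (weight-bound (b + n) b)
          (≤-trans
            (markov-^ w X ((b + n) ^ (d * k * X) * (b ^ e * (b + n) ^ F)) ((b + n) ^ e * b ^ F) Hs {{m*n≢0 (b + n) K}} (All.tabulate each))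
            (*-monoˡ-≤ ((b + n) ^ e * b ^ F) (^-monoˡ-≤ X (sum-filter-≤ many? w (regSamples n d))))))
        where
        X = (b + n) * K
        e = b * (d * τ)
        F = g * X
        Hs = filter many? (regSamples n d)
        w : Sample → ℕ
        w = vecProduct (edgeWeight (b + n) b)
        σ = sum (map w (regSamples n d))
        each : ∀ {H} → H ∈ Hs → (b + n) ^ (d * k * X) * (b ^ e * (b + n) ^ F) ≤ w H ^ X * ((b + n) ^ e * b ^ F)
        each {H} H∈ with (H∈samples , many) ← ∈-filter⁻ many? {xs = regSamples n d} H∈
          with (I , par , w≡) ← All.lookup (decompose (b + n) b) H∈samples =
          weight-≥-low (b + n) b (d * k) X (cutH S H) I e F par w≡ (m≤m+n b n)
            (many-exponent I (many-cross⇒few-internal d k m K Θ (trans k+m≡n n≡1+K) (cutH S H) I par many))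

      good : ∀ H → ¬ Few H → ¬ Many H →
        4 * d * (∣ cutH S H * total - cutSum n d S ∣ ^ 2) ≤ 9 * (cutSum n d S ^ 2)
      good H ¬few ¬many =
        relative-deviation K _ total ∣ cutH S H * K - y ∣ (cutSum n d S) d y (Θ + Θ)
          scaled (mean-cutH)
          (∣m-n∣≤ (<⇒≤ (≰⇒> ¬many)) (<⇒≤ (≰⇒> ¬few))) threshold
        where
        y = d * (k * m)
        lemma₁ : ∀ K x t → K * (x * t) ≡ t * (x * K)
        lemma₁ = solve-∀
        scaled : K * ∣ cutH S H * total - cutSum n d S ∣ ≡ total * ∣ cutH S H * K - y ∣
        scaled = begin-equality
          K * ∣ cutH S H * total - cutSum n d S ∣
            ≡⟨ *-distribˡ-∣-∣ K (cutH S H * total) (cutSum n d S) ⟩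
          ∣ K * (cutH S H * total) - K * cutSum n d S ∣
            ≡⟨ cong₂ ∣_-_∣ (lemma₁ K (cutH S H) total) (trans (mean-cutH) (*-comm y total)) ⟩
          ∣ total * (cutH S H * K) - total * y ∣
            ≡⟨ *-distribˡ-∣-∣ total (cutH S H * K) y ⟨
          total * ∣ cutH S H * K - y ∣ ∎

      bad⇒deviates : ∀ H → not (goodᵇ n d S H) ≡ true → Few H ⊎ Many H
      bad⇒deviates H bad with few? H | many? H
      ... | yes few | _        = inj₁ few
      ... | no _    | yes many = inj₂ many
      ... | no ¬few | no ¬many =
        contradiction (trans (sym bad) (cong not (Equivalence.to T-≡ (≤⇒≤ᵇ (good H ¬few ¬many))))) λ ()

    badCount-bound : badCount n d S * Δ ≤ 2 * length (regSamples n d)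
    badCount-bound = begin
      badCount n d S * Δ
        ≤⟨ *-monoˡ-≤ Δ (length-filter-⊎ (not ∘ goodᵇ n d S) few? many? bad⇒deviates (regSamples n d)) ⟩
      (length (filter few? (regSamples n d)) + length (filter many? (regSamples n d))) * Δ
        ≡⟨ *-distribʳ-+ Δ (length (filter few? (regSamples n d))) _ ⟩
      length (filter few? (regSamples n d)) * Δ + length (filter many? (regSamples n d)) * Δ
        ≤⟨ +-mono-≤ few-tail many-tail ⟩
      total + total
        ≡⟨ cong (total +_) (+-identityʳ total) ⟨
      2 * total ∎

-- Here 60 j ≤ √d < 60 (j + 1), and 45 j k m / K is the allowed deviation of the
-- number of internal edges; the Chernoff tilt 1 + n/(120 j k) is below half the optimal one,
-- which leaves enough of the exponent.
badCount-concentration : ∀ {n d} (S : Subset n) k m K j → .{{_ : NonZero K}} → .{{k≢0 : NonZero k}} → .{{j≢0 : NonZero j}} →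
  ∣ S ∣ ≡ k → k + m ≡ n → n ≡ suc K → 100 * k ≤ n →
  10 ≤ j → 3600 * (j * j) ≤ d → d ≤ 3600 * (suc j * suc j) →
  badCount n d S * ((n C k) * (n C k)) ≤ 2 * length (regSamples n d)
badCount-concentration {n} {d} S k m K j {{_}} {{k≢0}} {{j≢0}} ∣S∣≡k k+m≡n n≡1+K 100k≤n 10≤j 3600j²≤d d≤3600[1+j]² =
  badCount-bound d S k m K ∣S∣≡k k+m≡n n≡1+K k≤m
    (120 * (j * k)) (20 * (j * k)) ((n C k) * (n C k)) (45 * (j * k * m))
    {{m*n≢0 120 (j * k) {{_}} {{m*n≢0 j k}}}}
    (binomial²-growth n k j 100k≤n) budget threshold
  where
  k≤m : k ≤ m
  k≤m = ≤-trans (m≤n*m k 99) (+-cancelˡ-≤ k (99 * k) m (≤-trans 100k≤n (≤-reflexive (sym k+m≡n))))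
  budget : ∀ B → 120 * (j * k) ≤ B → n * (d * triangle k) + 20 * (j * k) * (B * K) ≤ B * (45 * (j * k * m))
  budget B b≤B = subst (λ x → n * (d * triangle k) + 20 * (j * k) * (B * pred x) ≤ B * (45 * (j * k * m))) n≡1+K
    (exponent-budget n m k j d B (sym k+m≡n) 100k≤n 10≤j d≤3600[1+j]² b≤B)
  -- 4 (2 * 45)² = 9 * 3600. Equivalently, the relative deviation 2Θ/(d k m) = 90 j/d is at most
  -- 1.5/√d because 60 j ≤ √d.
  lemma : ∀ d j k m → 4 * d * ((45 * (j * k * m) + 45 * (j * k * m)) * (45 * (j * k * m) + 45 * (j * k * m))) ≡
                      9 * (d * (k * m) * (3600 * (j * j) * (k * m)))
  lemma = solve-∀
  threshold : 4 * d * ((45 * (j * k * m) + 45 * (j * k * m)) * (45 * (j * k * m) + 45 * (j * k * m))) ≤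
              9 * (d * (k * m) * (d * (k * m)))
  threshold = ≤-trans (≤-reflexive (lemma d j k m))
    (*-monoʳ-≤ 9 (*-monoʳ-≤ (d * (k * m)) (*-monoˡ-≤ (k * m) 3600j²≤d)))

-- The bound 2 C⁻² is stronger than 2 C^(-1.01): after the power 100, the exponent 101 of C is
-- compared with 200. The inequality y ≤ y^p behind this also holds for y = 0.
power-form : ∀ p q x y t → .{{_ : NonZero p}} → q ≡ suc p → x * (y * y) ≤ 2 * t → x ^ p * y ^ q ≤ 2 ^ p * t ^ p
power-form p _ x y t refl h = begin
  x ^ p * (y * y ^ p)          ≤⟨ *-monoʳ-≤ (x ^ p) (*-monoˡ-≤ (y ^ p) (y≤y^p p y)) ⟩
  x ^ p * (y ^ p * y ^ p)      ≡⟨ cong (x ^ p *_) (^-distribʳ-* y y p) ⟨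
  x ^ p * (y * y) ^ p          ≡⟨ ^-distribʳ-* x (y * y) p ⟨
  (x * (y * y)) ^ p            ≤⟨ ^-monoˡ-≤ p h ⟩
  (2 * t) ^ p                  ≡⟨ ^-distribʳ-* 2 t p ⟩
  2 ^ p * t ^ p                ∎
  where
  y≤y^p : ∀ p y → .{{_ : NonZero p}} → y ≤ y ^ p
  y≤y^p (suc p) zero      = z≤n
  y≤y^p (suc p) y@(suc _) = m≤m*n y (y ^ p) {{m^n≢0 y p}}

∃-√-large : ∀ c d → .{{_ : NonZero c}} → c * (10 * 10) ≤ d →
  ∃ λ j → 10 ≤ j × c * (j * j) ≤ d × d ≤ c * (suc j * suc j)
∃-√-large c d d₀≤d with ∃-scaled-√ c d
... | j , lower , upper = j ,
  ≮⇒≥ (λ j<10 → <⇒≱ upper (≤-trans (*-monoʳ-≤ c (*-mono-≤ j<10 j<10)) d₀≤d)) , lower , <⇒≤ upper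

cut-concentration : ∀ d → 3600 * (10 * 10) ≤ d → ∀ n k → 1 ≤ k → 100 * k ≤ n → (S : Subset n) → ∣ S ∣ ≡ k →
  badCount n d S * ((n C k) * (n C k)) ≤ 2 * length (regSamples n d)
cut-concentration d d₀≤d n k 1≤k 100k≤n S ∣S∣≡k = let (j , 10≤j , lower , upper) = ∃-√-large 3600 d d₀≤d in
  badCount-concentration {n} {d} S k (n ∸ k) (pred n) j
    {{>-nonZero (≤-trans (s≤s z≤n) (pred-mono-≤ 100≤n))}} {{>-nonZero 1≤k}} {{>-nonZero (≤-trans (s≤s z≤n) 10≤j)}}
    ∣S∣≡k (m+[n∸m]≡n (≤-trans (m≤n*m k 100) 100k≤n)) (sym (suc-pred n {{>-nonZero (≤-trans (s≤s z≤n) 100≤n)}}))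
    100k≤n 10≤j lower upper
  where
  100≤n : 100 ≤ n
  100≤n = ≤-trans (*-monoʳ-≤ 100 1≤k) 100k≤n

mainTheorem5 : ∃ λ d₀ → ∀ d → d₀ ≤ d → ∃ λ n₀ → ∀ n → 2 ∣ n → n₀ ≤ n →
    ∀ k → 1 ≤ k → 100 * k ≤ n → (S : Subset n) → ∣ S ∣ ≡ k →
    badCount n d S ^ 100 * (n C k) ^ 101
    ≤ 2 ^ 100 * length (regSamples n d) ^ 100
-- This d₀ is where j, the integer part of √d/60, reaches 10. No lower bound on n is imposed by n₀,
-- since 1 ≤ k and 100 k ≤ n already give n ≥ 100.
mainTheorem5 = 3600 * (10 * 10) , λ d d₀≤d → 0 , λ n _ _ k 1≤k 100k≤n S ∣S∣≡k →
  power-form 100 101 (badCount n d S) (n C k) (length (regSamples n d)) refl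
    (cut-concentration d d₀≤d n k 1≤k 100k≤n S ∣S∣≡k)
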